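{- For every positive integer $n$, $$\hat{r}(2K_2,F_n)= \begin{cases}6n, & \text{if } 1\le n\le 2;\\ 5n+3, & \text{if } n\ge 3.\end{cases}$$
   Context: All graphs are finite and simple. For graphs $G_1,G_2$, the size Ramsey number $\hat{r}(G_1,G_2)$ is the smallest positive integer $m$ such that there exists a graph $G$ with $m$ edges with the property that for every coloring of the edges of $G$ with red and blue, $G$ contains a red subgraph isomorphic to $G_1$ or a blue subgraph isomorphic to $G_2$. $2K_2$ denotes the matching with two edges (two disjoint edges). The fan $F_n$ is the graph $K_1+nK_2$, i.e. $n$ disjoint edges together with one additional vertex joined to all $2n$ endpoints of these edges (so $F_n$ consists of $n$ triangles sharing exactly one common vertex). -}

module Defs where

open import Data.Nat using (ℕ; zero; suc; _+_; _*_; _≤_; _<ᵇ_; _≡ᵇ_; _%_)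
open import Data.Bool using (Bool; true; false; _∧_; _∨_; if_then_else_)
open import Data.Fin using (Fin; toℕ)
open import Data.List using (List; map; allFin)
open import Data.Nat.ListAction using (sum)
open import Data.Product using (Σ; _×_; _,_; ∃)
open import Data.Sum using (_⊎_)
open import Relation.Binary.PropositionalEquality using (_≡_)
open import Function.Definitions using (Injective)

record Graph : Set where
  field
    V     : ℕ
    adj   : Fin V → Fin V → Bool
    sym   : ∀ i j → adj i j ≡ adj j i
    irrefl : ∀ i → adj i i ≡ false
open Graph public

edgeCount : Graph → ℕ
edgeCount G = sum (map (λ i → sum (map (λ j →
  if (toℕ i <ᵇ toℕ j) ∧ adj G i j then 1 else 0) (allFin (V G)))) (allFin (V G)))

-- a red/blue edge colouring: a symmetric assignment of colours to pairs
-- (only its values on edges matter).  true = red, false = blue.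
Colour : Set
Colour = Bool

red blue : Colour
red = true
blue = false

record Colouring (G : Graph) : Set where
  field
    col    : Fin (V G) → Fin (V G) → Colour
    colSym : ∀ i j → col i j ≡ col j i
open Colouring public

HasMonoCopy : (G : Graph) → Colouring G → Colour → Graph → Set
HasMonoCopy G κ c H =
  Σ (Fin (V H) → Fin (V G)) λ f →
    Injective _≡_ _≡_ f ×
    (∀ a b → adj H a b ≡ true →
       (adj G (f a) (f b) ≡ true) × (col κ (f a) (f b) ≡ c))

Arrows : Graph → Graph → Graph → Set
Arrows G H₁ H₂ = (κ : Colouring G) → HasMonoCopy G κ red H₁ ⊎ HasMonoCopy G κ blue H₂

IsSizeRamsey : Graph → Graph → ℕ → Set
IsSizeRamsey H₁ H₂ m =
  (Σ Graph λ G → (edgeCount G ≡ m) × Arrows G H₁ H₂) ×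
  (∀ G → Arrows G H₁ H₂ → m ≤ edgeCount G)

symAdj : ∀ {n} → (ℕ → ℕ → Bool) → Fin n → Fin n → Bool
symAdj e i j = ((toℕ i <ᵇ toℕ j) ∧ e (toℕ i) (toℕ j)) ∨ ((toℕ j <ᵇ toℕ i) ∧ e (toℕ j) (toℕ i))

private
  ∨-comm' : ∀ a b → (a ∨ b) ≡ (b ∨ a)
  ∨-comm' false false = _≡_.refl
  ∨-comm' false true = _≡_.refl
  ∨-comm' true false = _≡_.refl
  ∨-comm' true true = _≡_.refl

  <ᵇ-irr : ∀ x → (x <ᵇ x) ≡ false
  <ᵇ-irr zero = _≡_.refl
  <ᵇ-irr (suc x) = <ᵇ-irr x

  irr : ∀ {n} (e : ℕ → ℕ → Bool) (i : Fin n) → symAdj e i i ≡ false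
  irr e i with toℕ i <ᵇ toℕ i | <ᵇ-irr (toℕ i)
  ... | false | _ = _≡_.refl

mkGraph : ℕ → (ℕ → ℕ → Bool) → Graph
mkGraph n e = record
  { V = n
  ; adj = symAdj e
  ; sym = λ i j → ∨-comm' ((toℕ i <ᵇ toℕ j) ∧ e (toℕ i) (toℕ j)) ((toℕ j <ᵇ toℕ i) ∧ e (toℕ j) (toℕ i))
  ; irrefl = irr e
  }

twoK2 : Graph
twoK2 = mkGraph 4 λ x y → ((x ≡ᵇ 0) ∧ (y ≡ᵇ 1)) ∨ ((x ≡ᵇ 2) ∧ (y ≡ᵇ 3))

-- fan F_n = K₁ + nK₂ : centre 0, vertices 1..2n, centre adjacent to all,
-- plus edges {2i+1, 2i+2} for i < n
Fan : ℕ → Graph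
Fan n = mkGraph (suc (2 * n)) λ x y → (x ≡ᵇ 0) ∨ ((x % 2 ≡ᵇ 1) ∧ (y ≡ᵇ suc x))

{-# OPTIONS --safe #-}
module Submission where

open import Defs
open import Data.Bool using (Bool; true; false; _∧_; _∨_; not; if_then_else_)
open import Data.Bool.Properties using (T-≡; T?; ∧-comm; ∨-comm; ¬-not; ∧-identityʳ) renaming (_≟_ to _≟ᵇ_)
open import Data.Empty using (⊥; ⊥-elim)
open import Data.Fin using (Fin; zero; suc; toℕ; splitAt; punchIn; _≟_; combine; remQuot; cast; _↑ˡ_; _↑ʳ_)
open import Data.Fin.Properties using (injective⇒≤; toℕ-injective; punchIn-injective; punchInᵢ≢i; any?; +↔⊎; pigeonhole; toℕ-cast; toℕ-combine; remQuot-combine; combine-remQuot; cast-involutive; suc-injective; <⇒≢; ↑ˡ-injective; ↑ʳ-injective; combine-injective; toℕ<n; splitAt-↑ˡ; splitAt-↑ʳ; toℕ-↑ˡ; toℕ-↑ʳ)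
open import Data.List using ([]; _∷_; map; allFin; length; filter; lookup; cartesianProduct; _++_)
open import Data.List.Membership.Propositional using (_∈_)
open import Data.List.Membership.Propositional.Properties using (∈-filter⁺; ∈-cartesianProduct⁺; ∈-allFin)
open import Data.List.Properties using (map-cong; map-tabulate; map-++; map-∘)
open import Data.List.Relation.Unary.Any using (index)
open import Data.List.Relation.Unary.Any.Properties using (lookup-index)
open import Data.Nat using (ℕ; zero; suc; _+_; _*_; _≤_; _<_; _<ᵇ_; z≤n; s≤s; _≡ᵇ_; _%_; _≤ᵇ_)
open import Data.Nat.DivMod using ([m+kn]%n≡m%n)
open import Data.Nat.ListAction using (sum)
open import Data.Nat.ListAction.Properties using (sum-++)
open import Data.Nat.Properties using (≤-refl; ≤-reflexive; ≤-trans; +-mono-≤; +-monoʳ-≤; +-monoˡ-≤; +-comm; +-identityʳ; m≤n+m; m≤m+n; <⇒<ᵇ; <-cmp; module ≤-Reasoning; *-comm; ≡ᵇ⇒≡; n<1+n; +-cancelʳ-≤; <⇒≱; ≰⇒>; _≤?_; ≤-pred; +-monoʳ-<; ≮⇒≥; _<?_; ≤⇒≤ᵇ; *-monoˡ-≤)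
open import Data.Nat.Tactic.RingSolver using (solve-∀)
open import Data.Product using (Σ; ∃; _×_; _,_; proj₁; proj₂)
open import Data.Sum using (_⊎_; inj₁; inj₂; [_,_]′)
open import Function using (_∘_; id)
open import Function.Bundles using (Equivalence; Injection)
open import Function.Definitions using (Injective)
open import Function.Properties.Inverse using (Inverse⇒Injection)
open import Relation.Binary.Definitions using (tri<; tri≈; tri>)
open import Relation.Binary.PropositionalEquality using (_≡_; _≢_; refl; trans; cong; cong₂; subst; module ≡-Reasoning) renaming (sym to ≡-sym)
open import Relation.Nullary using (Dec; yes; no; does; ¬_; contradiction)
open import Relation.Nullary.Decidable using (_⊎-dec_; _×-dec_; dec-true; dec-false)

-- A red graph without 2K₂ is a star or a triangle, so G arrows (2K₂ , Fₙ) only if a copy of Fₙ survives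
-- the deletion of any vertex and of the edges inside any three vertices.
--
-- Lower bound, assuming e(G) < min(6n , 5n + 3).  If u , v , w were three fan centres, the fan with no edge
-- inside {u , v , w} would give n edges missing all three, so e(G) ≥ 7n − 3; for n ≥ 3 this is too many, and
-- for n = 2 it forces centres to be pairwise adjacent of degree 2n, so no fan survives deleting a centre.
-- (For n = 1 there are two edge-disjoint triangles.)  With only two centres u , v, write d(u), d(v) ≥ 2n for
-- their degrees towards the rest and r ≥ n for the number of edges missing both; the total excess of
-- d(u) + d(v) + r + [uv] over 5n is at most 2.  The two rims share an edge xy (else r ≥ 2n and e(G) ≥ 6n), and
-- deleting x, or the edges inside {u , v , x} or {u , x , y}, each time costs one more unit of excess.
--
-- Upper bound: two disjoint fans for n ≤ 2, and Fₙ₊₁ with one extra vertex joined to n of its rim edges for n ≥ 3.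

-- Finite sums and counting

[_] : Bool → ℕ
[ b ] = if b then 1 else 0

Σ< : ∀ {n} → (Fin n → ℕ) → ℕ
Σ< {n} f = sum (map f (allFin n))

sum-map-+ : ∀ {X : Set} (f g : X → ℕ) xs → sum (map (λ x → f x + g x) xs) ≡ sum (map f xs) + sum (map g xs)
sum-map-+ f g [] = refl
sum-map-+ f g (x ∷ xs) rewrite sum-map-+ f g xs = interchange (f x) (g x) _ _
  where
  interchange : ∀ a b c d → a + b + (c + d) ≡ a + c + (b + d)
  interchange = solve-∀

sum-map-mono : ∀ {X : Set} {f g : X → ℕ} → (∀ x → f x ≤ g x) → ∀ xs → sum (map f xs) ≤ sum (map g xs)
sum-map-mono f≤g [] = z≤n
sum-map-mono f≤g (x ∷ xs) = +-mono-≤ (f≤g x) (sum-map-mono f≤g xs)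

Σ<-cong : ∀ {n} {f g : Fin n → ℕ} → (∀ i → f i ≡ g i) → Σ< f ≡ Σ< g
Σ<-cong f≗g = cong sum (map-cong f≗g (allFin _))

Σ<-suc : ∀ {n} (f : Fin (suc n) → ℕ) → Σ< f ≡ f zero + Σ< (f ∘ suc)
Σ<-suc f = cong (λ xs → f zero + sum xs) (trans (map-tabulate suc f) (≡-sym (map-tabulate id (f ∘ suc))))

Σ<-zero : ∀ n → Σ< {n} (λ _ → 0) ≡ 0
Σ<-zero zero = refl
Σ<-zero (suc n) = trans (Σ<-suc {n} (λ _ → 0)) (Σ<-zero n)

-- A point mass at `x`, which lets a single number be absorbed into a sum over all vertices.
only : ∀ {n} → Fin n → ℕ → Fin n → ℕ
only x k i = if does (i ≟ x) then k else 0

Σ<-only : ∀ {n} (x : Fin n) k → Σ< (only x k) ≡ k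
Σ<-only {suc n} zero k = begin
  Σ< (only {suc n} zero k)            ≡⟨ Σ<-suc {n} (only {suc n} zero k) ⟩
  k + Σ< {n} (λ _ → 0)        ≡⟨ cong (k +_) (Σ<-zero n) ⟩
  k + 0                       ≡⟨ +-identityʳ k ⟩
  k                           ∎
  where open ≡-Reasoning
Σ<-only {suc n} (suc x) k = trans (Σ<-suc {n} (only (suc x) k)) (trans (Σ<-cong {n} shift) (Σ<-only x k))
  where
  shift : ∀ i → only (suc x) k (suc i) ≡ only x k i
  shift i with i ≟ x
  ... | yes _ = refl
  ... | no  _ = refl

sum-map-[] : ∀ {X : Set} (p : X → Bool) xs → sum (map (λ x → [ p x ]) xs) ≡ length (filter (T? ∘ p) xs)
sum-map-[] p [] = refl
sum-map-[] p (x ∷ xs) with p x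
... | true  = cong suc (sum-map-[] p xs)
... | false = sum-map-[] p xs

-- Each `f i` survives the filtering of `xs` by `p`, and distinct values occupy distinct positions
-- of the filtered list.
injection⇒≤-count : ∀ {X : Set} {m} (p : X → Bool) xs (f : Fin m → X) → Injective _≡_ _≡_ f →
  (∀ i → f i ∈ xs) → (∀ i → p (f i) ≡ true) → m ≤ sum (map (λ x → [ p x ]) xs)
injection⇒≤-count {m = m} p xs f f-inj f∈xs pf =
  subst (m ≤_) (≡-sym (sum-map-[] p xs)) (injective⇒≤ position-injective)
  where
  ys = filter (T? ∘ p) xs

  f∈ys : ∀ i → f i ∈ ys
  f∈ys i = ∈-filter⁺ (T? ∘ p) (f∈xs i) (Equivalence.from T-≡ (pf i))

  position-injective : Injective _≡_ _≡_ (λ i → index (f∈ys i))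
  position-injective {i} {j} eq = f-inj (begin
    f i                        ≡⟨ lookup-index (f∈ys i) ⟩
    lookup ys (index (f∈ys i)) ≡⟨ cong (lookup ys) eq ⟩
    lookup ys (index (f∈ys j)) ≡⟨ lookup-index (f∈ys j) ⟨
    f j                        ∎)
    where open ≡-Reasoning

-- Turns the double sum in `edgeCount` into a count over one list of pairs, to which the bound by an
-- injection applies.
sum-cartesianProduct : ∀ {X Y : Set} (g : X × Y → ℕ) xs ys →
  sum (map (λ x → sum (map (λ y → g (x , y)) ys)) xs) ≡ sum (map g (cartesianProduct xs ys))
sum-cartesianProduct g [] ys = refl
sum-cartesianProduct g (x ∷ xs) ys = begin
  sum (map (λ y → g (x , y)) ys) + rest
    ≡⟨ cong₂ _+_ (cong sum (map-∘ ys)) (sum-cartesianProduct g xs ys) ⟩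
  sum (map g (map (x ,_) ys)) + sum (map g (cartesianProduct xs ys))
    ≡⟨ sum-++ (map g (map (x ,_) ys)) _ ⟨
  sum (map g (map (x ,_) ys) ++ map g (cartesianProduct xs ys))
    ≡⟨ cong sum (map-++ g (map (x ,_) ys) _) ⟨
  sum (map g (cartesianProduct (x ∷ xs) ys)) ∎
  where
  open ≡-Reasoning
  rest = sum (map (λ x′ → sum (map (λ y → g (x′ , y)) ys)) xs)

-- Degrees and vertex deletion

true≢false : ∀ {b} → b ≡ true → b ≡ false → ⊥
true≢false refl ()

∧-true⁻ : ∀ a {b} → a ∧ b ≡ true → a ≡ true × b ≡ true
∧-true⁻ true eq = refl , eq

does-yes : ∀ {P : Set} (P? : Dec P) → does P? ≡ true → P
does-yes (yes p) _ = p

Adjacent : (G : Graph) → Fin (V G) → Fin (V G) → Set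
Adjacent G i j = adj G i j ≡ true

Adjacent-sym : ∀ G {i j} → Adjacent G i j → Adjacent G j i
Adjacent-sym G {i} {j} ij = trans (Graph.sym G j i) ij

Adjacent⇒≢ : ∀ G {i j} → Adjacent G i j → i ≢ j
Adjacent⇒≢ G {i} ij refl = true≢false ij (irrefl G i)

infixl 6 _∖_
-- The vertex `x` stays behind as an isolated vertex. All deletions thus keep the same vertex type,
-- and fans and edge families carry over without renaming.
_∖_ : (G : Graph) → Fin (V G) → Graph
G ∖ x = record
  { V      = V G
  ; adj    = λ i j → adj G i j ∧ kept i j
  ; sym    = λ i j → cong₂ _∧_ (Graph.sym G i j) (∧-comm (not (does (i ≟ x))) _)
  ; irrefl = λ i → cong (_∧ kept i i) (irrefl G i)
  }
  where
  kept : Fin (V G) → Fin (V G) → Bool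
  kept i j = not (does (i ≟ x)) ∧ not (does (j ≟ x))

∖-adj⁺ : ∀ G {x i j} → Adjacent G i j → i ≢ x → j ≢ x → Adjacent (G ∖ x) i j
∖-adj⁺ G {x} {i} {j} ij i≢x j≢x
  rewrite ij | dec-false (i ≟ x) i≢x | dec-false (j ≟ x) j≢x = refl

deg : (G : Graph) → Fin (V G) → ℕ
deg G x = Σ< (λ j → [ adj G x j ])

deg-remove : ∀ G {c x} → c ≢ x → deg G c ≡ [ adj G c x ] + deg (G ∖ x) c
deg-remove G {c} {x} c≢x = begin
  deg G c                                                             ≡⟨ Σ<-cong split ⟩
  Σ< (λ j → only x [ adj G c x ] j + [ adj (G ∖ x) c j ])             ≡⟨ sum-map-+ (only x [ adj G c x ]) _ (allFin (V G)) ⟩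
  Σ< (only x [ adj G c x ]) + deg (G ∖ x) c                           ≡⟨ cong (_+ deg (G ∖ x) c) (Σ<-only x _) ⟩
  [ adj G c x ] + deg (G ∖ x) c                                       ∎
  where
  open ≡-Reasoning
  split : ∀ j → [ adj G c j ] ≡ only x [ adj G c x ] j + [ adj (G ∖ x) c j ]
  split j rewrite dec-false (c ≟ x) c≢x with j ≟ x | adj G c j in eq
  ... | yes refl | true  rewrite eq = refl
  ... | yes refl | false rewrite eq = refl
  ... | no _     | true  = refl
  ... | no _     | false = refl

<ᵇ-true : ∀ {m n} → m < n → (m <ᵇ n) ≡ true
<ᵇ-true m<n = Equivalence.to T-≡ (<⇒<ᵇ m<n)

-- Row `i` of `edgeCount` counts the edges from `i` to larger vertices. The edges at `x` are row
-- `x`, summed by `up`, and one entry `down i` in the row of each smaller neighbour `i`; the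
-- comparison is then made row by row.
deg+edgeCount-remove≤ : ∀ G x → deg G x + edgeCount (G ∖ x) ≤ edgeCount G
deg+edgeCount-remove≤ G x = begin
  deg G x + edgeCount (G ∖ x)
    ≤⟨ +-monoˡ-≤ _ (sum-map-mono above-or-below (allFin n)) ⟩
  Σ< (λ j → up j + down j) + edgeCount (G ∖ x)
    ≡⟨ cong (_+ edgeCount (G ∖ x)) (sum-map-+ up down (allFin n)) ⟩
  Σ< up + Σ< down + edgeCount (G ∖ x)
    ≡⟨ cong (λ s → s + Σ< down + edgeCount (G ∖ x)) (Σ<-only x (Σ< up)) ⟨
  Σ< (only x (Σ< up)) + Σ< down + edgeCount (G ∖ x)
    ≡⟨ cong (_+ edgeCount (G ∖ x)) (sum-map-+ (only x (Σ< up)) down (allFin n)) ⟨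
  Σ< (λ i → only x (Σ< up) i + down i) + edgeCount (G ∖ x)
    ≡⟨ sum-map-+ (λ i → only x (Σ< up) i + down i) _ (allFin n) ⟨
  Σ< (λ i → only x (Σ< up) i + down i + Σ< (λ j → [ (toℕ i <ᵇ toℕ j) ∧ adj (G ∖ x) i j ]))
    ≤⟨ sum-map-mono row (allFin n) ⟩
  edgeCount G ∎
  where
  open ≤-Reasoning
  n = V G

  up down : Fin n → ℕ
  up   j = [ (toℕ x <ᵇ toℕ j) ∧ adj G x j ]
  down i = [ (toℕ i <ᵇ toℕ x) ∧ adj G i x ]

  above-or-below : ∀ j → [ adj G x j ] ≤ up j + down j
  above-or-below j with adj G x j in eq
  ... | false = z≤n
  ... | true with <-cmp (toℕ x) (toℕ j)
  ...   | tri< x<j _ _ rewrite <ᵇ-true x<j = s≤s z≤n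
  ...   | tri≈ _ x≡j _ = contradiction (toℕ-injective x≡j) (Adjacent⇒≢ G eq)
  ...   | tri> _ _ j<x rewrite <ᵇ-true j<x | Adjacent-sym G eq = m≤n+m 1 _

  row : ∀ i → only x (Σ< up) i + down i + Σ< (λ j → [ (toℕ i <ᵇ toℕ j) ∧ adj (G ∖ x) i j ])
            ≤ Σ< (λ j → [ (toℕ i <ᵇ toℕ j) ∧ adj G i j ])
  row i with i ≟ x
  ... | yes refl = begin
    Σ< up + down x + Σ< (λ j → [ (toℕ x <ᵇ toℕ j) ∧ (adj G x j ∧ false) ])
      ≡⟨ cong₂ _+_ (cong (Σ< up +_) nothing-down) (trans (Σ<-cong (λ j → nothing (toℕ x <ᵇ toℕ j) (adj G x j))) (Σ<-zero n)) ⟩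
    Σ< up + 0 + 0                ≡⟨ trans (+-identityʳ _) (+-identityʳ _) ⟩
    Σ< up                        ∎
    where
    nothing : ∀ a b → [ a ∧ (b ∧ false) ] ≡ 0
    nothing false _     = refl
    nothing true  false = refl
    nothing true  true  = refl
    nothing-down : down x ≡ 0
    nothing-down rewrite irrefl G x with toℕ x <ᵇ toℕ x
    ... | true  = refl
    ... | false = refl
  ... | no i≢x = begin
    down i + Σ< rest                       ≡⟨ cong (_+ Σ< rest) (Σ<-only x (down i)) ⟨
    Σ< (only x (down i)) + Σ< rest         ≡⟨ sum-map-+ (only x (down i)) rest (allFin n) ⟨
    Σ< (λ j → only x (down i) j + rest j)  ≤⟨ sum-map-mono cell (allFin n) ⟩
    Σ< (λ j → [ (toℕ i <ᵇ toℕ j) ∧ adj G i j ]) ∎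
    where
    rest : Fin n → ℕ
    rest j = [ (toℕ i <ᵇ toℕ j) ∧ (adj G i j ∧ not (does (j ≟ x))) ]
    -- Column `x` carries `down i` and is empty in `rest`; in every other column `rest` agrees with
    -- `G`.
    cell : ∀ j → only x (down i) j + rest j ≤ [ (toℕ i <ᵇ toℕ j) ∧ adj G i j ]
    cell j with j ≟ x | toℕ i <ᵇ toℕ j in i<ᵇj | adj G i j in ij
    ... | yes refl | true  | true  rewrite i<ᵇj | ij = ≤-refl
    ... | yes refl | true  | false rewrite i<ᵇj | ij = ≤-refl
    ... | yes refl | false | _     rewrite i<ᵇj = ≤-refl
    ... | no _     | true  | true  = ≤-refl
    ... | no _     | true  | false = ≤-refl
    ... | no _     | false | _     = ≤-refl

-- Families of distinct edges

SameEdge : {X : Set} → X → X → X → X → Set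
SameEdge a b c d = (a ≡ c × b ≡ d) ⊎ (a ≡ d × b ≡ c)

sameEdge? : ∀ {n} (a b c d : Fin n) → Dec (SameEdge a b c d)
sameEdge? a b c d = ((a ≟ c) ×-dec (b ≟ d)) ⊎-dec ((a ≟ d) ×-dec (b ≟ c))

SameEdge-sym : ∀ {X : Set} {a b c d : X} → SameEdge a b c d → SameEdge c d a b
SameEdge-sym (inj₁ (p , q)) = inj₁ (≡-sym p , ≡-sym q)
SameEdge-sym (inj₂ (p , q)) = inj₂ (≡-sym q , ≡-sym p)

-- Members are compared as unordered pairs, so this is an injection of `Fin m` into the edge set,
-- which serves to bound the number of edges from below.
record Edges (G : Graph) (m : ℕ) : Set where
  field
    src tgt  : Fin m → Fin (V G)
    edge     : ∀ i → Adjacent G (src i) (tgt i)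
    distinct : ∀ i j → SameEdge (src i) (tgt i) (src j) (tgt j) → i ≡ j
open Edges

-- `edgeCount` sees an edge only with its smaller endpoint first.
oriented : ∀ G {i j} → Adjacent G i j →
  Σ (Fin (V G) × Fin (V G)) λ (k , l) → SameEdge i j k l × ((toℕ k <ᵇ toℕ l) ∧ adj G k l ≡ true)
oriented G {i} {j} ij with <-cmp (toℕ i) (toℕ j)
... | tri< i<j _ _ = (i , j) , inj₁ (refl , refl) , cong₂ _∧_ (<ᵇ-true i<j) ij
... | tri≈ _ i≡j _ = contradiction (toℕ-injective i≡j) (Adjacent⇒≢ G ij)
... | tri> _ _ j<i = (j , i) , inj₂ (refl , refl) , cong₂ _∧_ (<ᵇ-true j<i) (Adjacent-sym G ij)

edges⇒≤-edgeCount : ∀ {G m} → Edges G m → m ≤ edgeCount G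
edges⇒≤-edgeCount {G} {m} E = subst (m ≤_) (≡-sym (sum-cartesianProduct (λ e → [ present e ]) (allFin (V G)) (allFin (V G))))
  (injection⇒≤-count present _ pair pair-injective
    (λ i → ∈-cartesianProduct⁺ (∈-allFin _) (∈-allFin _))
    (λ i → proj₂ (proj₂ (oriented G (edge E i)))))
  where
  present : Fin (V G) × Fin (V G) → Bool
  present (i , j) = (toℕ i <ᵇ toℕ j) ∧ adj G i j

  pair : Fin m → Fin (V G) × Fin (V G)
  pair i = proj₁ (oriented G (edge E i))

  through : ∀ {a b c d k l : Fin (V G)} → SameEdge a b k l → SameEdge c d k l → SameEdge a b c d
  through (inj₁ (refl , refl)) q = SameEdge-sym q
  through (inj₂ (refl , refl)) (inj₁ (refl , refl)) = inj₂ (refl , refl)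
  through (inj₂ (refl , refl)) (inj₂ (refl , refl)) = inj₁ (refl , refl)

  pair-injective : Injective _≡_ _≡_ pair
  pair-injective {i} {j} eq with oriented G (edge E i) | oriented G (edge E j)
  pair-injective {i} {j} refl | _ , p , _ | _ , q , _ = distinct E i j (through p q)

AvoidedBy : ∀ {G m} → Edges G m → Fin (V G) → Set
AvoidedBy E x = ∀ i → src E i ≢ x × tgt E i ≢ x

edges-∖ : ∀ {G m} (E : Edges G m) {x} → AvoidedBy E x → Edges (G ∖ x) m
edges-∖ {G} E av = record
  { src = src E ; tgt = tgt E
  ; edge = λ i → ∖-adj⁺ G (edge E i) (proj₁ (av i)) (proj₂ (av i))
  ; distinct = distinct E }

edges-drop : ∀ {G m} → Edges G (suc m) → Fin (suc m) → Edges G m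
edges-drop E i = record
  { src = src E ∘ punchIn i ; tgt = tgt E ∘ punchIn i
  ; edge = λ j → edge E (punchIn i j)
  ; distinct = λ j k s → punchIn-injective i j k (distinct E _ _ s) }

edges-[] : ∀ {G} → Edges G 0
edges-[] = record { src = λ () ; tgt = λ () ; edge = λ () ; distinct = λ () }

edges-∷ : ∀ {G m} (E : Edges G m) {x y} → Adjacent G x y →
  (∀ i → ¬ SameEdge (src E i) (tgt E i) x y) → Edges G (suc m)
edges-∷ E {x} {y} xy new = record
  { src = λ { zero → x ; (suc i) → src E i }
  ; tgt = λ { zero → y ; (suc i) → tgt E i }
  ; edge = λ { zero → xy ; (suc i) → edge E i }
  ; distinct = λ { zero zero _ → refl
                 ; zero (suc j) s → ⊥-elim (new j (SameEdge-sym s))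
                 ; (suc i) zero s → ⊥-elim (new i s)
                 ; (suc i) (suc j) s → cong suc (distinct E i j s) } }

splitAt-injective : ∀ m {n} → Injective _≡_ _≡_ (splitAt m {n})
splitAt-injective m {n} = Injection.injective (Inverse⇒Injection (+↔⊎ {m} {n}))

edges-++ : ∀ {G m k} (E : Edges G m) (E′ : Edges G k) →
  (∀ i j → ¬ SameEdge (src E i) (tgt E i) (src E′ j) (tgt E′ j)) → Edges G (m + k)
edges-++ {G} {m} E E′ disjoint = record
  { src = [ src E , src E′ ]′ ∘ splitAt m
  ; tgt = [ tgt E , tgt E′ ]′ ∘ splitAt m
  ; edge = λ i → edge′ (splitAt m i)
  ; distinct = λ i j s → splitAt-injective m (distinct′ (splitAt m i) (splitAt m j) s) }
  where
  edge′ : ∀ s → Adjacent G ([ src E , src E′ ]′ s) ([ tgt E , tgt E′ ]′ s)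
  edge′ (inj₁ i) = edge E i
  edge′ (inj₂ i) = edge E′ i
  distinct′ : ∀ s t → SameEdge ([ src E , src E′ ]′ s) ([ tgt E , tgt E′ ]′ s)
                               ([ src E , src E′ ]′ t) ([ tgt E , tgt E′ ]′ t) → s ≡ t
  distinct′ (inj₁ i) (inj₁ j) s = cong inj₁ (distinct E i j s)
  distinct′ (inj₁ i) (inj₂ j) s = ⊥-elim (disjoint i j s)
  distinct′ (inj₂ i) (inj₁ j) s = ⊥-elim (disjoint j i (SameEdge-sym s))
  distinct′ (inj₂ i) (inj₂ j) s = cong inj₂ (distinct E′ i j s)

-- Fans inside a graph

-- An embedded Fₙ indexed by its triangles, the pages. That the centre differs from the rim vertices
-- follows from the spokes.
record FanAt (G : Graph) (n : ℕ) (c : Fin (V G)) : Set where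
  field
    left right      : Fin n → Fin (V G)
    spokeˡ          : ∀ i → Adjacent G c (left i)
    spokeʳ          : ∀ i → Adjacent G c (right i)
    rim             : ∀ i → Adjacent G (left i) (right i)
    left-injective  : ∀ {i j} → left i ≡ left j → i ≡ j
    right-injective : ∀ {i j} → right i ≡ right j → i ≡ j
    left≢right      : ∀ i j → left i ≢ right j
open FanAt

EveryEdge : ∀ {G n c} → FanAt G n c → (Fin (V G) → Fin (V G) → Set) → Set
EveryEdge {c = c} F P = ∀ i → P c (left F i) × P c (right F i) × P (left F i) (right F i)

-- Numbering of the vertices of `Fan n`, and copies of it as fans

slot : ∀ {n} → Fin n → Fin 2 → Fin (2 * n)
slot {n} i r = cast (*-comm n 2) (combine i r)

unslot : ∀ {n} → Fin (2 * n) → Fin n × Fin 2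
unslot {n} j = remQuot 2 (cast (*-comm 2 n) j)

unslot-slot : ∀ {n} (i : Fin n) r → unslot (slot i r) ≡ (i , r)
unslot-slot {n} i r = trans (cong (remQuot 2) (cast-involutive (*-comm 2 n) (*-comm n 2) (combine i r))) (remQuot-combine i r)

slot-unslot : ∀ {n} (j : Fin (2 * n)) → slot (proj₁ (unslot {n} j)) (proj₂ (unslot {n} j)) ≡ j
slot-unslot {n} j = trans (cong (cast (*-comm n 2)) (combine-remQuot {n} 2 (cast (*-comm 2 n) j))) (cast-involutive (*-comm n 2) (*-comm 2 n) j)

unslot-injective : ∀ {n} {j k : Fin (2 * n)} → unslot {n} j ≡ unslot {n} k → j ≡ k
unslot-injective {n} {j} {k} eq = trans (≡-sym (slot-unslot {n} j)) (trans (cong (λ (i , r) → slot i r) eq) (slot-unslot {n} k))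

-- After the shift by one for the centre, the ends of page `i` are the vertices 2i + 1 and 2i + 2,
-- as in `Fan`.
toℕ-slot : ∀ {n} (i : Fin n) r → toℕ (slot i r) ≡ toℕ r + toℕ i * 2
toℕ-slot i r = trans (toℕ-cast _ (combine i r)) (trans (toℕ-combine i r) (reorder (toℕ i) (toℕ r)))
  where
  reorder : ∀ a b → 2 * a + b ≡ b + a * 2
  reorder = solve-∀

≡ᵇ-refl : ∀ n → (n ≡ᵇ n) ≡ true
≡ᵇ-refl zero = refl
≡ᵇ-refl (suc n) = ≡ᵇ-refl n

[1+2i]%2 : ∀ i → suc (i * 2) % 2 ≡ 1
[1+2i]%2 i = [m+kn]%n≡m%n 1 i 2

[2+2i]%2 : ∀ i → suc (suc (i * 2)) % 2 ≡ 0
[2+2i]%2 i = [m+kn]%n≡m%n 2 i 2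

Fan-rim : ∀ {n} (i : Fin n) → Adjacent (Fan n) (suc (slot i zero)) (suc (slot i (suc zero)))
Fan-rim i rewrite toℕ-slot i zero | toℕ-slot i (suc zero) | <ᵇ-true (n<1+n (toℕ i * 2))
  | [1+2i]%2 (toℕ i) | ≡ᵇ-refl (toℕ i * 2) = refl

∨-true⁻ : ∀ a {b} → a ∨ b ≡ true → a ≡ true ⊎ b ≡ true
∨-true⁻ true  _  = inj₁ refl
∨-true⁻ false eq = inj₂ eq

-- The edges of `Fan n` with the smaller vertex first; matching on them replaces the Boolean formula
-- in `Fan`.
data FanEdge (n : ℕ) : Fin (suc (2 * n)) → Fin (suc (2 * n)) → Set where
  onSpoke : ∀ j → FanEdge n zero (suc j)
  onRim   : ∀ (i : Fin n) → FanEdge n (suc (slot {n} i zero)) (suc (slot {n} i (suc zero)))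

fanEdge : ∀ {n} {x y : Fin (suc (2 * n))} → Adjacent (Fan n) x y → FanEdge n x y ⊎ FanEdge n y x
fanEdge {n} {x} {y} xy = [ inj₁ ∘ increasing x y , inj₂ ∘ increasing y x ]′
  (∨-true⁻ ((toℕ x <ᵇ toℕ y) ∧ e (toℕ x) (toℕ y)) xy)
  where
  e : ℕ → ℕ → Bool
  e a b = (a ≡ᵇ 0) ∨ ((a % 2 ≡ᵇ 1) ∧ (b ≡ᵇ suc a))

  from-slot : ∀ i r (k : Fin (2 * n)) → e (suc (toℕ (slot {n} i r))) (suc (toℕ k)) ≡ true → FanEdge n (suc (slot {n} i r)) (suc k)
  from-slot i zero k h = subst (λ k → FanEdge n (suc (slot {n} i zero)) (suc k)) (toℕ-injective (begin
    toℕ (slot i (suc zero)) ≡⟨ toℕ-slot i (suc zero) ⟩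
    suc (toℕ i * 2)         ≡⟨ cong suc (toℕ-slot i zero) ⟨
    suc (toℕ (slot i zero)) ≡⟨ ≡ᵇ⇒≡ (toℕ k) _ (Equivalence.from T-≡ (proj₂ (∧-true⁻ (suc (toℕ (slot i zero)) % 2 ≡ᵇ 1) h))) ⟨
    toℕ k                   ∎)) (onRim i)
    where open ≡-Reasoning
  -- The second end of a page has an even number, so no rim edge starts there.
  from-slot i (suc zero) k h rewrite toℕ-slot i (suc zero) | [2+2i]%2 (toℕ i) = contradiction h λ ()

  increasing : ∀ x y → (toℕ x <ᵇ toℕ y) ∧ e (toℕ x) (toℕ y) ≡ true → FanEdge n x y
  increasing zero    (suc j) _ = onSpoke j
  increasing (suc j) (suc k) h = subst (λ j → e (suc (toℕ j)) (suc (toℕ k)) ≡ true → FanEdge n (suc j) (suc k))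
    (slot-unslot {n} j) (from-slot (proj₁ (unslot {n} j)) (proj₂ (unslot {n} j)) k) (proj₂ (∧-true⁻ (toℕ j <ᵇ toℕ k) h))

fanEnd : ∀ {G n c} → FanAt G n c → Fin n × Fin 2 → Fin (V G)
fanEnd F (i , zero)  = left F i
fanEnd F (i , suc _) = right F i

fanEnd-spoke : ∀ {G n c} (F : FanAt G n c) s → Adjacent G c (fanEnd F s)
fanEnd-spoke F (i , zero)  = spokeˡ F i
fanEnd-spoke F (i , suc _) = spokeʳ F i

fanEnd-injective : ∀ {G n c} (F : FanAt G n c) s t → fanEnd F s ≡ fanEnd F t → s ≡ t
fanEnd-injective F (i , zero)     (j , zero)     eq = cong (_, zero) (left-injective F eq)
fanEnd-injective F (i , zero)     (j , suc _)    eq = contradiction eq (left≢right F i j)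
fanEnd-injective F (i , suc _)    (j , zero)     eq = contradiction (≡-sym eq) (left≢right F j i)
fanEnd-injective F (i , suc zero) (j , suc zero) eq = cong (_, suc zero) (right-injective F eq)

module _ {G : Graph} (κ : Colouring G) {n : ℕ} where

  Blue : Fin (V G) → Fin (V G) → Set
  Blue i j = col κ i j ≡ blue

  copy⇒fan : HasMonoCopy G κ blue (Fan n) → Σ (Fin (V G)) λ c → Σ (FanAt G n c) λ F → EveryEdge F Blue
  copy⇒fan (f , f-inj , f-edge) = f zero , record
    { left  = λ i → f (suc (slot i zero))
    ; right = λ i → f (suc (slot i (suc zero)))
    ; spokeˡ = λ i → proj₁ (f-edge _ _ refl)
    ; spokeʳ = λ i → proj₁ (f-edge _ _ refl)
    ; rim = λ i → proj₁ (f-edge _ _ (Fan-rim i))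
    ; left-injective = λ eq → cong proj₁ (slot-injective eq)
    ; right-injective = λ eq → cong proj₁ (slot-injective eq)
    ; left≢right = λ i j eq → contradiction (cong proj₂ (slot-injective {i} {zero} {j} eq)) λ ()
    } , λ i → proj₂ (f-edge _ _ refl) , proj₂ (f-edge _ _ refl) , proj₂ (f-edge _ _ (Fan-rim i))
    where
    slot-injective : ∀ {i r j s} → f (suc (slot i r)) ≡ f (suc (slot j s)) → (i , r) ≡ (j , s)
    slot-injective {i} {r} {j} {s} eq = trans (≡-sym (unslot-slot i r))
      (trans (cong (unslot {n}) (suc-injective (f-inj eq))) (unslot-slot j s))

  fan⇒copy : ∀ {c} (F : FanAt G n c) → EveryEdge F Blue → HasMonoCopy G κ blue (Fan n)
  fan⇒copy {c} F F-blue = f , (λ {x} {y} → f-injective x y) , λ x y xy → [ f-edge , swap ∘ f-edge ]′ (fanEdge {n} {x} {y} xy)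
    where
    f : Fin (suc (2 * n)) → Fin (V G)
    f zero    = c
    f (suc j) = fanEnd F (unslot {n} j)

    blue-spoke : ∀ s → col κ c (fanEnd F s) ≡ blue
    blue-spoke (i , zero)  = proj₁ (F-blue i)
    blue-spoke (i , suc _) = proj₁ (proj₂ (F-blue i))

    f-injective : ∀ x y → f x ≡ f y → x ≡ y
    f-injective zero zero _ = refl
    f-injective zero (suc j) eq = contradiction eq (Adjacent⇒≢ G (fanEnd-spoke F (unslot {n} j)))
    f-injective (suc j) zero eq = contradiction (≡-sym eq) (Adjacent⇒≢ G (fanEnd-spoke F (unslot {n} j)))
    f-injective (suc j) (suc k) eq = cong suc (unslot-injective {n} (fanEnd-injective F (unslot {n} j) (unslot {n} k) eq))

    swap : ∀ {i j} → Adjacent G i j × col κ i j ≡ blue → Adjacent G j i × col κ j i ≡ blue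
    swap {i} {j} (ij , ij-blue) = Adjacent-sym G ij , trans (colSym κ j i) ij-blue

    f-edge : ∀ {x y} → FanEdge n x y → Adjacent G (f x) (f y) × col κ (f x) (f y) ≡ blue
    f-edge (onSpoke j) = fanEnd-spoke F (unslot {n} j) , blue-spoke (unslot {n} j)
    f-edge (onRim i) rewrite unslot-slot i zero | unslot-slot i (suc zero) = rim F i , proj₂ (proj₂ (F-blue i))

Avoids : ∀ {G n c} → FanAt G n c → Fin (V G) → Set
Avoids {c = c} F x = c ≢ x × (∀ i → left F i ≢ x) × (∀ i → right F i ≢ x)

-- Triples of vertices

data Among {X : Set} (x y z : X) : X → Set where
  first  : Among x y z x
  second : Among x y z y
  third  : Among x y z z

among? : ∀ {n} (x y z i : Fin n) → Dec (Among x y z i)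
among? x y z i with i ≟ x | i ≟ y | i ≟ z
... | yes refl | _ | _ = yes first
... | no _ | yes refl | _ = yes second
... | no _ | no _ | yes refl = yes third
... | no i≢x | no i≢y | no i≢z = no λ { first → i≢x refl ; second → i≢y refl ; third → i≢z refl }

Among-index : ∀ {X : Set} {x y z i : X} → Among x y z i → Fin 3
Among-index first  = zero
Among-index second = suc zero
Among-index third  = suc (suc zero)

Among-index-injective : ∀ {X : Set} {x y z i j : X} (p : Among x y z i) (q : Among x y z j) →
  Among-index p ≡ Among-index q → i ≡ j
Among-index-injective first  first  _ = refl
Among-index-injective second second _ = refl
Among-index-injective third  third  _ = refl

-- Rules out a red 2K₂ in a triangle colouring: its four vertices would share three places.
Among-pigeonhole : ∀ {X : Set} {x y z : X} (f : Fin 4 → X) → Injective _≡_ _≡_ f → ¬ (∀ i → Among x y z (f i))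
Among-pigeonhole f f-inj f∈ with pigeonhole ≤-refl (λ i → Among-index (f∈ i))
... | i , j , i<j , eq = <⇒≢ i<j (f-inj (Among-index-injective (f∈ i) (f∈ j) eq))

NotWithin : {X : Set} (x y z i j : X) → Set
NotWithin x y z i j = Among x y z i → Among x y z j → ⊥

-- Fans forced by star and triangle colourings

starColouring : ∀ G → Fin (V G) → Colouring G
starColouring G x = record
  { col    = λ i j → does (i ≟ x) ∨ does (j ≟ x)
  ; colSym = λ i j → ∨-comm (does (i ≟ x)) _ }

star-red : ∀ G x i j → col (starColouring G x) i j ≡ red → i ≡ x ⊎ j ≡ x
star-red G x i j h with i ≟ x | j ≟ x
... | yes i≡x | _       = inj₁ i≡x
... | no _    | yes j≡x = inj₂ j≡x
star-red G x i j () | no _ | no _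

star-blue : ∀ G x i j → col (starColouring G x) i j ≡ blue → i ≢ x × j ≢ x
star-blue G x i j h with i ≟ x | j ≟ x
star-blue G x i j () | yes _ | _
star-blue G x i j () | no _  | yes _
... | no i≢x | no j≢x = i≢x , j≢x

triangleColouring : ∀ G (x y z : Fin (V G)) → Colouring G
triangleColouring G x y z = record
  { col    = λ i j → does (among? x y z i) ∧ does (among? x y z j)
  ; colSym = λ i j → ∧-comm (does (among? x y z i)) _ }

triangle-red : ∀ G x y z i j → col (triangleColouring G x y z) i j ≡ red → Among x y z i × Among x y z j
triangle-red G x y z i j h with ∧-true⁻ (does (among? x y z i)) h
... | p , q = does-yes (among? x y z i) p , does-yes (among? x y z j) q

triangle-blue : ∀ G x y z i j → col (triangleColouring G x y z) i j ≡ blue → NotWithin x y z i j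
triangle-blue G x y z i j h p q
  rewrite dec-true (among? x y z i) p | dec-true (among? x y z j) q = contradiction h λ ()

blueColouring : ∀ G → Colouring G
blueColouring G = record { col = λ _ _ → blue ; colSym = λ _ _ → refl }

module _ {G : Graph} {n : ℕ} (arrows : Arrows G twoK2 (Fan n)) where

  some-fan : Σ (Fin (V G)) (FanAt G n)
  some-fan with arrows (blueColouring G)
  ... | inj₁ (_ , _ , f-edge) = contradiction (proj₂ (f-edge zero (suc zero) refl)) λ ()
  ... | inj₂ copy with copy⇒fan (blueColouring G) {n} copy
  ...   | c , F , _ = c , F

  -- Disjoint edges cannot both contain `x`, so colouring the star at `x` red forces a blue fan. No
  -- edge of that fan meets `x`; as n ≥ 1, every vertex of it lies on an edge, so the fan misses `x`
  -- altogether.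
  fan-avoiding-vertex : 1 ≤ n → ∀ x → Σ (Fin (V G)) λ c → Σ (FanAt G n c) λ F → Avoids F x
  fan-avoiding-vertex (s≤s _) x with arrows (starColouring G x)
  ... | inj₂ copy with copy⇒fan (starColouring G x) {n} copy
  ...   | c , F , F-blue =
          c , F
        , proj₁ (star-blue G x c (left F zero) (proj₁ (F-blue zero)))
        , (λ i → proj₂ (star-blue G x c (left F i) (proj₁ (F-blue i))))
        , (λ i → proj₂ (star-blue G x c (right F i) (proj₁ (proj₂ (F-blue i)))))
  fan-avoiding-vertex (s≤s _) x | inj₁ (f , f-inj , f-edge) = disjoint
    (star-red G x _ _ (proj₂ (f-edge zero (suc zero) refl)))
    (star-red G x _ _ (proj₂ (f-edge (suc (suc zero)) (suc (suc (suc zero))) refl)))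
    where
    clash : ∀ {i j} {X : Set} → i ≢ j → f i ≡ x → f j ≡ x → X
    clash i≢j p q = contradiction (f-inj (trans p (≡-sym q))) i≢j
    disjoint : ∀ {X : Set} → f zero ≡ x ⊎ f (suc zero) ≡ x → f (suc (suc zero)) ≡ x ⊎ f (suc (suc (suc zero))) ≡ x → X
    disjoint (inj₁ p) (inj₁ q) = clash (λ ()) p q
    disjoint (inj₁ p) (inj₂ q) = clash (λ ()) p q
    disjoint (inj₂ p) (inj₁ q) = clash (λ ()) p q
    disjoint (inj₂ p) (inj₂ q) = clash (λ ()) p q

  -- With the pairs inside the triple red there is no red 2K₂. The blue fan may still pass through
  -- `x`, `y` and `z`, but uses no edge joining two of them.
  fan-avoiding-triangle : ∀ x y z → Σ (Fin (V G)) λ c → Σ (FanAt G n c) λ F → EveryEdge F (NotWithin x y z)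
  fan-avoiding-triangle x y z with arrows (triangleColouring G x y z)
  ... | inj₂ copy with copy⇒fan (triangleColouring G x y z) {n} copy
  ...   | c , F , F-blue =
          c , F , λ i → triangle-blue G x y z c (left F i) (proj₁ (F-blue i))
                      , triangle-blue G x y z c (right F i) (proj₁ (proj₂ (F-blue i)))
                      , triangle-blue G x y z (left F i) (right F i) (proj₂ (proj₂ (F-blue i)))
  fan-avoiding-triangle x y z | inj₁ (f , f-inj , f-edge) = ⊥-elim (Among-pigeonhole f f-inj λ
    { zero → proj₁ 01-among ; (suc zero) → proj₂ 01-among
    ; (suc (suc zero)) → proj₁ 23-among ; (suc (suc (suc zero))) → proj₂ 23-among })
    where
    01-among = triangle-red G x y z (f zero) (f (suc zero)) (proj₂ (f-edge zero (suc zero) refl))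
    23-among = triangle-red G x y z (f (suc (suc zero))) (f (suc (suc (suc zero))))
                 (proj₂ (f-edge (suc (suc zero)) (suc (suc (suc zero))) refl))

-- Edges and degrees supplied by a fan

adjacent? : ∀ G i j → Dec (Adjacent G i j)
adjacent? G i j = adj G i j ≟ᵇ true

rimEdges : ∀ {G n c} → FanAt G n c → Edges G n
rimEdges F = record
  { src = left F ; tgt = right F ; edge = rim F
  ; distinct = λ { i j (inj₁ (p , _)) → left-injective F p
                 ; i j (inj₂ (p , _)) → contradiction p (left≢right F i j) } }

rimEdges-avoid : ∀ {G n c x} (F : FanAt G n c) → Avoids F x → AvoidedBy (rimEdges F) x
rimEdges-avoid F (_ , l , r) i = l i , r i

rimEdges-avoid-centre : ∀ {G n c} (F : FanAt G n c) → AvoidedBy (rimEdges F) c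
rimEdges-avoid-centre {G} F i = Adjacent⇒≢ G (spokeˡ F i) ∘ ≡-sym , Adjacent⇒≢ G (spokeʳ F i) ∘ ≡-sym

-- Every vertex of a fan other than its centre is a neighbour of the centre.
avoids-nonadjacent : ∀ {G n c x} (F : FanAt G n c) → c ≢ x → ¬ Adjacent G c x → Avoids F x
avoids-nonadjacent F c≢x ¬cx = c≢x , (λ i → λ { refl → ¬cx (spokeˡ F i) }) , (λ i → λ { refl → ¬cx (spokeʳ F i) })

-- If `w` were on the rim, the spoke from `c` to `w` would be an edge inside the triple.
avoids-triangle : ∀ {G n c x y z w} (F : FanAt G n c) → EveryEdge F (NotWithin x y z) →
  Among x y z c → Among x y z w → c ≢ w → Avoids F w
avoids-triangle F outside c∈ w∈ c≢w =
  c≢w , (λ i → λ { refl → proj₁ (outside i) c∈ w∈ }) , (λ i → λ { refl → proj₁ (proj₂ (outside i)) c∈ w∈ })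

fan-∖ : ∀ {G n c x} (F : FanAt G n c) → Avoids F x → FanAt (G ∖ x) n c
fan-∖ {G} F (c≢x , l , r) = record
  { left = left F ; right = right F
  ; spokeˡ = λ i → ∖-adj⁺ G (spokeˡ F i) c≢x (l i)
  ; spokeʳ = λ i → ∖-adj⁺ G (spokeʳ F i) c≢x (r i)
  ; rim = λ i → ∖-adj⁺ G (rim F i) (l i) (r i)
  ; left-injective = left-injective F
  ; right-injective = right-injective F
  ; left≢right = left≢right F }

fan⇒≤-deg : ∀ {G n c} → FanAt G n c → 2 * n ≤ deg G c
fan⇒≤-deg {G} {n} {c} F = injection⇒≤-count (adj G c) (allFin (V G)) (fanEnd F ∘ unslot {n})
  (λ {i} {j} eq → unslot-injective {n} (fanEnd-injective F (unslot {n} i) (unslot {n} j) eq))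
  (λ i → ∈-allFin _) (λ i → fanEnd-spoke F (unslot {n} i))

deg-∷ : ∀ G {c x k} → Adjacent G c x → k ≤ deg (G ∖ x) c → suc k ≤ deg G c
deg-∷ G {c} {x} {k} cx k≤ = begin
  suc k                         ≤⟨ s≤s k≤ ⟩
  suc (deg (G ∖ x) c)           ≡⟨ cong (λ b → [ b ] + deg (G ∖ x) c) cx ⟨
  [ adj G c x ] + deg (G ∖ x) c ≡⟨ deg-remove G (Adjacent⇒≢ G cx) ⟨
  deg G c                       ∎
  where open ≤-Reasoning

-- `x` is a neighbour of the centre in addition to the 2n rim vertices.
fan⇒<-deg : ∀ {G n c x} (F : FanAt G n c) → Avoids F x → Adjacent G c x → 1 + 2 * n ≤ deg G c
fan⇒<-deg {G} F av cx = deg-∷ G cx (fan⇒≤-deg (fan-∖ F av))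

fan⇒+2≤-deg : ∀ {G n c x y} (F : FanAt G n c) → Avoids F x → Avoids F y → x ≢ y →
  Adjacent G c x → Adjacent G c y → 2 + 2 * n ≤ deg G c
fan⇒+2≤-deg {G} F avx avy x≢y cx cy =
  deg-∷ G cx (fan⇒<-deg (fan-∖ F avx) avy (∖-adj⁺ G cy (Adjacent⇒≢ G cx) (x≢y ∘ ≡-sym)))

-- `z` is on the rim of `F`, in page `at`, and `partner` is its mate in the rim matching.
record Hit {G n c} (F : FanAt G n c) (z : Fin (V G)) : Set where
  constructor hit
  field
    at      : Fin n
    partner : Fin (V G)
    same    : SameEdge (left F at) (right F at) z partner
open Hit

avoids? : ∀ {G n c z} (F : FanAt G n c) → c ≢ z → Avoids F z ⊎ Hit F z
avoids? {z = z} F c≢z with any? (λ i → (left F i ≟ z) ⊎-dec (right F i ≟ z))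
... | yes (i , inj₁ p) = inj₂ (hit i _ (inj₁ (p , refl)))
... | yes (i , inj₂ p) = inj₂ (hit i _ (inj₂ (refl , p)))
... | no ¬hit = inj₁ (c≢z , (λ i p → ¬hit (i , inj₁ p)) , (λ i p → ¬hit (i , inj₂ p)))

SameEdge-adjacent : ∀ G {a b c d} → SameEdge a b c d → Adjacent G a b → Adjacent G c d
SameEdge-adjacent G (inj₁ (refl , refl)) ab = ab
SameEdge-adjacent G (inj₂ (refl , refl)) ab = Adjacent-sym G ab

module _ {G : Graph} {n : ℕ} {c z : Fin (V G)} {F : FanAt G n c} where

  hit-edge : (h : Hit F z) → Adjacent G z (partner h)
  hit-edge h = SameEdge-adjacent G (same h) (rim F (at h))

  hit-spoke : (h : Hit F z) → Adjacent G c (partner h)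
  hit-spoke (hit i p (inj₁ (refl , refl))) = spokeʳ F i
  hit-spoke (hit i p (inj₂ (refl , refl))) = spokeˡ F i

  hit-partner≢ : ∀ {w} (h : Hit F z) → Avoids F w → partner h ≢ w
  hit-partner≢ (hit i p (inj₁ (refl , refl))) (_ , l , r) = r i
  hit-partner≢ (hit i p (inj₂ (refl , refl))) (_ , l , r) = l i

  hit-outside : ∀ {x y w} (h : Hit F z) → EveryEdge F (NotWithin x y w) → NotWithin x y w z (partner h)
  hit-outside (hit i p (inj₁ (refl , refl))) outside a b = proj₂ (proj₂ (outside i)) a b
  hit-outside (hit i p (inj₂ (refl , refl))) outside a b = proj₂ (proj₂ (outside i)) b a

-- The rim is a matching, so without the edge through `z` and `p` nothing in it meets either vertex.
drop-avoids : ∀ {G m c} (F : FanAt G (suc m) c) i {z p} → SameEdge (left F i) (right F i) z p →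
  AvoidedBy (edges-drop (rimEdges F) i) z × AvoidedBy (edges-drop (rimEdges F) i) p
drop-avoids F i (inj₁ (refl , refl)) =
    (λ j → (λ eq → punchInᵢ≢i i j (left-injective F eq)) , (λ eq → left≢right F _ _ (≡-sym eq)))
  , (λ j → (λ eq → left≢right F _ _ eq) , (λ eq → punchInᵢ≢i i j (right-injective F eq)))
drop-avoids F i (inj₂ (refl , refl)) with drop-avoids F i (inj₁ (refl , refl))
... | z , p = p , z

edges-∖-≤ : ∀ G x {a b} → a ≤ deg G x → b ≤ edgeCount (G ∖ x) → a + b ≤ edgeCount G
edges-∖-≤ G x a≤ b≤ = ≤-trans (+-mono-≤ a≤ b≤) (deg+edgeCount-remove≤ G x)

-- At most two fan centres

module TwoCentres {G : Graph} {m : ℕ}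
  (avoiding  : ∀ x → Σ (Fin (V G)) λ c → Σ (FanAt G (suc m) c) λ F → Avoids F x)
  (avoiding△ : ∀ x y z → Σ (Fin (V G)) λ c → Σ (FanAt G (suc m) c) λ F → EveryEdge F (NotWithin x y z))
  (no-third  : ∀ {u v w} → FanAt G (suc m) u → FanAt G (suc m) v → FanAt G (suc m) w → u ≢ v → u ≢ w → v ≢ w → ⊥)
  (e<6n      : edgeCount G < 6 * suc m)
  (e<5n+3    : edgeCount G < 5 * suc m + 3)
  where

  n : ℕ
  n = suc m

  module Pair {u v : Fin (V G)} (u≢v : u ≢ v)
    (Fᵤ : FanAt G n u) (Fᵤ∌v : Avoids Fᵤ v) (Fᵥ : FanAt G n v) (Fᵥ∌u : Avoids Fᵥ u) where

    R : Graph
    R = G ∖ u ∖ v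

    dᵤ dᵥ r : ℕ
    dᵤ = deg (G ∖ v) u
    dᵥ = deg (G ∖ u) v
    r  = edgeCount R

    v≢u : v ≢ u
    v≢u = u≢v ∘ ≡-sym

    -- The edge uv if present, the other edges at `u`, the other edges at `v` and the edges of `R`
    -- are disjoint classes.
    total : ∀ {a b c} → a ≤ dᵤ → b ≤ dᵥ → c ≤ r → [ adj G u v ] + a + (b + c) ≤ edgeCount G
    total {a} a≤ b≤ c≤ = edges-∖-≤ G u
      (subst ([ adj G u v ] + a ≤_) (≡-sym (deg-remove G u≢v)) (+-monoʳ-≤ _ a≤))
      (edges-∖-≤ (G ∖ u) v b≤ c≤)

    -- `i`, `j`, `k` are the excesses of `dᵤ`, `dᵥ`, `r` over 2n, 2n, n; the bound is what e(G) ≤ 5n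
    -- + 2 leaves. Every contradiction below exhibits a total excess of 3.
    budget : ∀ i j k → i + 2 * n ≤ dᵤ → j + 2 * n ≤ dᵥ → k + n ≤ r → [ adj G u v ] + (i + j + k) ≤ 2
    budget i j k i≤ j≤ k≤ = +-cancelʳ-≤ (5 * n) _ 2 (begin
      [ adj G u v ] + (i + j + k) + 5 * n                       ≡⟨ regroup [ adj G u v ] i j k n ⟩
      [ adj G u v ] + (i + 2 * n) + ((j + 2 * n) + (k + n))     ≤⟨ total i≤ j≤ k≤ ⟩
      edgeCount G                                               ≤⟨ ≤-pred (subst (edgeCount G <_) (+-comm (5 * n) 3) e<5n+3) ⟩
      2 + 5 * n                                                 ∎)
      where
      open ≤-Reasoning
      regroup : ∀ e i j k n → e + (i + j + k) + 5 * n ≡ e + (i + 2 * n) + ((j + 2 * n) + (k + n))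
      regroup = solve-∀

    2n≤dᵤ : 2 * n ≤ dᵤ
    2n≤dᵤ = fan⇒≤-deg (fan-∖ Fᵤ Fᵤ∌v)

    2n≤dᵥ : 2 * n ≤ dᵥ
    2n≤dᵥ = fan⇒≤-deg (fan-∖ Fᵥ Fᵥ∌u)

    into-R : ∀ {k} (E : Edges G k) → AvoidedBy E u → AvoidedBy E v → Edges R k
    into-R E ¬u ¬v = edges-∖ (edges-∖ E ¬u) ¬v

    R-adj : ∀ {x y} → Adjacent G x y → x ≢ u → x ≢ v → y ≢ u → y ≢ v → Adjacent R x y
    R-adj xy x≢u x≢v y≢u y≢v = ∖-adj⁺ (G ∖ u) (∖-adj⁺ G xy x≢u y≢u) x≢v y≢v

    rimᵤ : (F : FanAt G n u) → Avoids F v → Edges R n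
    rimᵤ F F∌v = into-R (rimEdges F) (rimEdges-avoid-centre F) (rimEdges-avoid F F∌v)

    rimᵥ : (F : FanAt G n v) → Avoids F u → Edges R n
    rimᵥ F F∌u = into-R (rimEdges F) (rimEdges-avoid F F∌u) (rimEdges-avoid-centre F)

    n≤r : n ≤ r
    n≤r = edges⇒≤-edgeCount (rimᵤ Fᵤ Fᵤ∌v)

    centre : ∀ {c} → FanAt G n c → c ≡ u ⊎ c ≡ v
    centre {c} F with c ≟ u | c ≟ v
    ... | yes c≡u | _       = inj₁ c≡u
    ... | no _    | yes c≡v = inj₂ c≡v
    ... | no c≢u  | no c≢v  = ⊥-elim (no-third F Fᵤ Fᵥ c≢u c≢v u≢v)

    beyondᵤ : ∀ {x} (F : FanAt G n u) → Avoids F v → Avoids F x → Adjacent G u x → x ≢ v → 1 + 2 * n ≤ dᵤ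
    beyondᵤ F F∌v F∌x ux x≢v = fan⇒<-deg (fan-∖ F F∌v) F∌x (∖-adj⁺ G ux u≢v x≢v)

    beyondᵥ : ∀ {x} (F : FanAt G n v) → Avoids F u → Avoids F x → Adjacent G v x → x ≢ u → 1 + 2 * n ≤ dᵥ
    beyondᵥ F F∌u F∌x vx x≢u = fan⇒<-deg (fan-∖ F F∌u) F∌x (∖-adj⁺ G vx v≢u x≢u)

    -- With u and v nonadjacent, deleting an end of a rim edge leaves n rim edges elsewhere in R.
    nonadjacent⇒n<r : ¬ Adjacent G u v → suc n ≤ r
    nonadjacent⇒n<r ¬uv with avoiding (left Fᵤ zero)
    ... | c , F , F∌x = edges-∖-≤ R x (deg-∷ R x∼y z≤n) (edges⇒≤-edgeCount (rest (centre F)))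
      where
      x = left Fᵤ zero
      x∼y : Adjacent R x (right Fᵤ zero)
      x∼y = edge (rimᵤ Fᵤ Fᵤ∌v) zero
      rest : c ≡ u ⊎ c ≡ v → Edges (R ∖ x) n
      rest (inj₁ refl) = edges-∖ (rimᵤ F (avoids-nonadjacent F u≢v ¬uv)) (rimEdges-avoid F F∌x)
      rest (inj₂ refl) = edges-∖ (rimᵥ F (avoids-nonadjacent F v≢u (¬uv ∘ Adjacent-sym G))) (rimEdges-avoid F F∌x)

    SharedRim : Set
    SharedRim = ∃ λ i → ∃ λ j → SameEdge (left Fᵤ i) (right Fᵤ i) (left Fᵥ j) (right Fᵥ j)

    shared : SharedRim
    shared with any? (λ i → any? (λ j → sameEdge? (left Fᵤ i) (right Fᵤ i) (left Fᵥ j) (right Fᵥ j)))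
    ... | yes s = s
    ... | no ¬s = ⊥-elim (<⇒≱ e<6n (begin
      6 * n                                           ≡⟨ regroup n ⟩
      0 + 2 * n + (2 * n + (n + n))                   ≤⟨ +-monoˡ-≤ _ (+-monoˡ-≤ (2 * n) (z≤n {[ adj G u v ]})) ⟩
      [ adj G u v ] + 2 * n + (2 * n + (n + n))       ≤⟨ total 2n≤dᵤ 2n≤dᵥ (edges⇒≤-edgeCount both) ⟩
      edgeCount G                                     ∎))
      where
      open ≤-Reasoning
      both : Edges R (n + n)
      both = edges-++ (rimᵤ Fᵤ Fᵤ∌v) (rimᵥ Fᵥ Fᵥ∌u) (λ i j s → ¬s (i , j , s))
      regroup : ∀ n → 6 * n ≡ 0 + 2 * n + (2 * n + (n + n))
      regroup = solve-∀

    -- As `dᵥ` is exactly 2n, a fan at `v` avoiding `u` has all other neighbours of `v` on its rim.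
    -- Hence it cannot miss `x` or `y`, the ends of the shared rim edge.
    module Tight (dᵥ≤2n : dᵥ ≤ 2 * n) {x y : Fin (V G)} (ux : Adjacent G u x) (uy : Adjacent G u y)
      (x≢v : x ≢ v) (y≢v : y ≢ v) (xy : Adjacent G x y)
      (j : Fin n) (xy∈Fᵥ : SameEdge (left Fᵥ j) (right Fᵥ j) x y) where

      dᵥ-tight : ¬ (1 + 2 * n ≤ dᵥ)
      dᵥ-tight lt = <⇒≱ lt dᵥ≤2n

      x≢u : x ≢ u
      x≢u = Adjacent⇒≢ G ux ∘ ≡-sym

      y≢u : y ≢ u
      y≢u = Adjacent⇒≢ G uy ∘ ≡-sym

      x≢y : x ≢ y
      x≢y = Adjacent⇒≢ G xy

      vy : Adjacent G v y
      vy = hit-spoke {F = Fᵥ} (hit j y xy∈Fᵥ)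

      vx : Adjacent G v x
      vx = hit-spoke {F = Fᵥ} (hit j x ([ inj₂ , inj₁ ]′ xy∈Fᵥ))

      R-xy : Adjacent R x y
      R-xy = R-adj xy x≢u x≢v y≢u y≢v

      -- Two perfect matchings of N(v), exactly one of which uses xy, span at least n + 2 edges.
      two-matchings : (F : FanAt G n v) → Avoids F u → EveryEdge F (NotWithin u x y) → 2 + n ≤ r
      two-matchings F F∌u outside with avoids? {z = x} F (x≢v ∘ ≡-sym) | avoids? {z = y} F (y≢v ∘ ≡-sym)
      ... | inj₁ F∌x | _ = ⊥-elim (dᵥ-tight (beyondᵥ F F∌u F∌x vx x≢u))
      ... | inj₂ _ | inj₁ F∌y = ⊥-elim (dᵥ-tight (beyondᵥ F F∌u F∌y vy y≢u))
      -- Two edges at `x`, namely to `y` and to its mate in `F`; one more at `y`, to its mate in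
      -- `F`; and the m = n - 1 rim edges of `Fᵥ` other than xy.
      ... | inj₂ hx | inj₂ hy = edges-∖-≤ R x
              (deg-∷ R R-xy (deg-∷ (R ∖ y) (∖-adj⁺ R x∼x′ x≢y x′≢y) z≤n))
              (edges-∖-≤ (R ∖ x) y (deg-∷ (R ∖ x) (∖-adj⁺ R y∼y′ (x≢y ∘ ≡-sym) y′≢x) z≤n)
                (edges⇒≤-edgeCount (edges-∖ (edges-∖ others (proj₁ others-avoid)) (proj₂ others-avoid))))
        where
        x′≢y : partner hx ≢ y
        x′≢y eq = hit-outside hx outside second (subst (Among u x y) (≡-sym eq) third)
        y′≢x : partner hy ≢ x
        y′≢x eq = hit-outside hy outside third (subst (Among u x y) (≡-sym eq) second)
        x∼x′ : Adjacent R x (partner hx)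
        x∼x′ = R-adj (hit-edge hx) x≢u x≢v (hit-partner≢ hx F∌u) (Adjacent⇒≢ G (hit-spoke hx) ∘ ≡-sym)
        y∼y′ : Adjacent R y (partner hy)
        y∼y′ = R-adj (hit-edge hy) y≢u y≢v (hit-partner≢ hy F∌u) (Adjacent⇒≢ G (hit-spoke hy) ∘ ≡-sym)
        others : Edges R m
        others = edges-drop (rimᵥ Fᵥ Fᵥ∌u) j
        others-avoid = drop-avoids Fᵥ j xy∈Fᵥ

      -- A fan missing `x` must be centred at `u`, so `dᵤ` has excess 1, and `r` has excess 1 by
      -- nonadjacency. A fan with no edge inside {u, x, y} adds a unit: centred at `u` it misses
      -- both `x` and `y`, centred at `v` it gives a second matching of N(v).
      nonadjacent⇒⊥ : ¬ Adjacent G u v → ⊥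
      nonadjacent⇒⊥ ¬uv = after-x (avoiding x)
        where
        off-v : (F : FanAt G n u) → Avoids F v
        off-v F = avoids-nonadjacent F u≢v ¬uv
        off-u : (F : FanAt G n v) → Avoids F u
        off-u F = avoids-nonadjacent F v≢u (¬uv ∘ Adjacent-sym G)

        over : ∀ k → [ adj G u v ] + (3 + k) ≤ 2 → ⊥
        over k h with ≤-trans (m≤n+m (3 + k) [ adj G u v ]) h
        ... | s≤s (s≤s ())

        after-triangle : 1 + 2 * n ≤ dᵤ → (Σ (Fin (V G)) λ c → Σ (FanAt G n c) λ F → EveryEdge F (NotWithin u x y)) → ⊥
        after-triangle 2n<dᵤ (c , F , outside) with centre F
        ... | inj₁ refl = over 0 (budget 2 0 1
                (fan⇒+2≤-deg (fan-∖ F (off-v F))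
                  (avoids-triangle F outside first second (x≢u ∘ ≡-sym))
                  (avoids-triangle F outside first third (y≢u ∘ ≡-sym)) x≢y
                  (∖-adj⁺ G ux u≢v x≢v) (∖-adj⁺ G uy u≢v y≢v))
                2n≤dᵥ (nonadjacent⇒n<r ¬uv))
        ... | inj₂ refl = over 0 (budget 1 0 2 2n<dᵤ 2n≤dᵥ (two-matchings F (off-u F) outside))

        after-x : (Σ (Fin (V G)) λ c → Σ (FanAt G n c) λ F → Avoids F x) → ⊥
        after-x (c , F , F∌x) with centre F
        ... | inj₁ refl = after-triangle (beyondᵤ F (off-v F) F∌x ux x≢v) (avoiding△ u x y)
        ... | inj₂ refl = dᵥ-tight (beyondᵥ F (off-u F) F∌x vx x≢u)

      -- The edge uv costs one unit. A fan with no edge inside {u, v, x} cannot be centred at `v`,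
      -- so it is centred at `u`, misses `v` and `x`, and raises `dᵤ`. The triple {u, x, y} yields
      -- the third unit, in `r`.
      adjacent⇒⊥ : Adjacent G u v → ⊥
      adjacent⇒⊥ uv = after-uvx (avoiding△ u v x)
        where
        -- By tightness `p` is on the rim of `Fᵥ`, and the edge to its mate lies in `R`. With xy and
        -- the n - 1 edges of `E`, none of which meets `p`, this makes n + 1.
        common-neighbour : ∀ {p} → Adjacent G u p → Adjacent G v p → p ≢ x → p ≢ y →
          (E : Edges R m) → AvoidedBy E p → (∀ i → ¬ SameEdge (src E i) (tgt E i) x y) → suc n ≤ r
        common-neighbour {p} up vp p≢x p≢y E E∌p E∌xy with avoids? {z = p} Fᵥ (Adjacent⇒≢ G vp)
        ... | inj₁ Fᵥ∌p = ⊥-elim (dᵥ-tight (beyondᵥ Fᵥ Fᵥ∌u Fᵥ∌p vp (Adjacent⇒≢ G up ∘ ≡-sym)))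
        ... | inj₂ h = edges-∖-≤ R p (deg-∷ R p∼q z≤n)
                (edges⇒≤-edgeCount (edges-∷ (edges-∖ E E∌p) (∖-adj⁺ R R-xy (p≢x ∘ ≡-sym) (p≢y ∘ ≡-sym)) E∌xy))
          where
          p∼q : Adjacent R p (partner h)
          p∼q = R-adj (hit-edge h) (Adjacent⇒≢ G up ∘ ≡-sym) (Adjacent⇒≢ G vp ∘ ≡-sym)
                  (hit-partner≢ h Fᵥ∌u) (Adjacent⇒≢ G (hit-spoke h) ∘ ≡-sym)

        rim≢xy : ∀ {c} (F : FanAt G n c) → EveryEdge F (NotWithin u x y) → ∀ i → ¬ SameEdge (left F i) (right F i) x y
        rim≢xy F outside i (inj₁ (p , q)) = proj₂ (proj₂ (outside i))
          (subst (Among u x y) (≡-sym p) second) (subst (Among u x y) (≡-sym q) third)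
        rim≢xy F outside i (inj₂ (p , q)) = proj₂ (proj₂ (outside i))
          (subst (Among u x y) (≡-sym p) third) (subst (Among u x y) (≡-sym q) second)

        n<r : (Σ (Fin (V G)) λ c → Σ (FanAt G n c) λ F → EveryEdge F (NotWithin u x y)) → suc n ≤ r
        n<r (c , F , outside) with centre F
        n<r (c , F , outside) | inj₁ refl with avoids? {z = v} F u≢v
        ... | inj₁ F∌v = edges⇒≤-edgeCount (edges-∷ (rimᵤ F F∌v) R-xy (rim≢xy F outside))
        -- The page of `F` through `v` makes its partner a common neighbour of `u` and `v`; only the
        -- rim edge of that page is lost to `R`.
        ... | inj₂ h = common-neighbour (hit-spoke h) (hit-edge h) p≢x p≢y
                (into-R (edges-drop (rimEdges F) (at h)) (λ i → rimEdges-avoid-centre F _) (proj₁ dropped))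
                (proj₂ dropped) (λ i → rim≢xy F outside _)
          where
          dropped = drop-avoids F (at h) (same h)
          p≢x : partner h ≢ x
          p≢x eq = hit-partner≢ h (avoids-triangle F outside first second (x≢u ∘ ≡-sym)) eq
          p≢y : partner h ≢ y
          p≢y eq = hit-partner≢ h (avoids-triangle F outside first third (y≢u ∘ ≡-sym)) eq
        n<r (c , F , outside) | inj₂ refl with avoids? {z = u} F v≢u
        ... | inj₁ F∌u = edges⇒≤-edgeCount (edges-∷ (rimᵥ F F∌u) R-xy (rim≢xy F outside))
        ... | inj₂ h = common-neighbour (hit-edge h) (hit-spoke h) p≢x p≢y
                (into-R (edges-drop (rimEdges F) (at h)) (proj₁ dropped) (λ i → rimEdges-avoid-centre F _))
                (proj₂ dropped) (λ i → rim≢xy F outside _)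
          where
          dropped = drop-avoids F (at h) (same h)
          p≢x : partner h ≢ x
          -- Here the partner is joined to `u` by a rim edge of `F`, which may not lie inside {u, x,
          -- y}.
          p≢x eq = hit-outside h outside first (subst (Among u x y) (≡-sym eq) second)
          p≢y : partner h ≢ y
          p≢y eq = hit-outside h outside first (subst (Among u x y) (≡-sym eq) third)

        after-uvx : (Σ (Fin (V G)) λ c → Σ (FanAt G n c) λ F → EveryEdge F (NotWithin u v x)) → ⊥
        after-uvx (c , F , outside) with centre F
        ... | inj₂ refl = dᵥ-tight (beyondᵥ F (avoids-triangle F outside second first v≢u)
                (avoids-triangle F outside second third (x≢v ∘ ≡-sym)) vx x≢u)
        ... | inj₁ refl with subst (λ b → [ b ] + 2 ≤ 2) uv (budget 1 0 1
                (beyondᵤ F (avoids-triangle F outside first second u≢v)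
                  (avoids-triangle F outside first third (x≢u ∘ ≡-sym)) ux x≢v)
                2n≤dᵥ (n<r (avoiding△ u x y)))
        ...   | s≤s (s≤s ())

    tight⇒⊥ : dᵥ ≤ 2 * n → ⊥
    tight⇒⊥ dᵥ≤2n with shared | adjacent? G u v
    ... | i , j , s | yes uv = Tight.adjacent⇒⊥ dᵥ≤2n (spokeˡ Fᵤ i) (spokeʳ Fᵤ i)
            (proj₁ (proj₂ Fᵤ∌v) i) (proj₂ (proj₂ Fᵤ∌v) i) (rim Fᵤ i) j (SameEdge-sym s) uv
    ... | i , j , s | no ¬uv = Tight.nonadjacent⇒⊥ dᵥ≤2n (spokeˡ Fᵤ i) (spokeʳ Fᵤ i)
            (proj₁ (proj₂ Fᵤ∌v) i) (proj₂ (proj₂ Fᵤ∌v) i) (rim Fᵤ i) j (SameEdge-sym s) ¬uv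

    -- Both degrees have excess 1; the third unit is the edge uv or, in its absence, an extra edge
    -- of `R`.
    loose⇒⊥ : 1 + 2 * n ≤ dᵤ → 1 + 2 * n ≤ dᵥ → ⊥
    loose⇒⊥ 2n<dᵤ 2n<dᵥ with adjacent? G u v
    ... | yes uv with subst (λ b → [ b ] + 2 ≤ 2) uv (budget 1 1 0 2n<dᵤ 2n<dᵥ n≤r)
    ...   | s≤s (s≤s ())
    loose⇒⊥ 2n<dᵤ 2n<dᵥ | no ¬uv with ≤-trans (m≤n+m 3 [ adj G u v ]) (budget 1 1 1 2n<dᵤ 2n<dᵥ (nonadjacent⇒n<r ¬uv))
    ... | s≤s (s≤s ())

  pair⇒⊥ : ∀ {u v} → u ≢ v → (Fᵤ : FanAt G n u) → Avoids Fᵤ v → (Fᵥ : FanAt G n v) → Avoids Fᵥ u → ⊥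
  pair⇒⊥ {u} {v} u≢v Fᵤ Fᵤ∌v Fᵥ Fᵥ∌u with deg (G ∖ u) v ≤? 2 * n | deg (G ∖ v) u ≤? 2 * n
  ... | yes dᵥ≤ | _ = Pair.tight⇒⊥ u≢v Fᵤ Fᵤ∌v Fᵥ Fᵥ∌u dᵥ≤
  ... | no _ | yes dᵤ≤ = Pair.tight⇒⊥ (u≢v ∘ ≡-sym) Fᵥ Fᵥ∌u Fᵤ Fᵤ∌v dᵤ≤
  ... | no dᵥ≰ | no dᵤ≰ = Pair.loose⇒⊥ u≢v Fᵤ Fᵤ∌v Fᵥ Fᵥ∌u (≰⇒> dᵤ≰) (≰⇒> dᵥ≰)

  -- The given fan at `u` may pass through `v`. It is replaced by one that misses `v`, whose centre
  -- must again be `u` because there is no third centre.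
  two-centres⇒⊥ : Σ (Fin (V G)) (FanAt G n) → ⊥
  two-centres⇒⊥ (u , Fᵤ) with avoiding u
  ... | v , Fᵥ , Fᵥ∌u with avoiding v
  ...   | w , F , F∌v with w ≟ u
  ...     | yes refl = pair⇒⊥ (proj₁ Fᵥ∌u ∘ ≡-sym) F F∌v Fᵥ Fᵥ∌u
  ...     | no w≢u = no-third Fᵤ Fᵥ F (proj₁ Fᵥ∌u ∘ ≡-sym) (w≢u ∘ ≡-sym) (proj₁ F∌v ∘ ≡-sym)

-- Three fan centres

[]≤1 : ∀ b → [ b ] ≤ 1
[]≤1 true  = ≤-refl
[]≤1 false = z≤n

∖-adj : ∀ G {x i j} → i ≢ x → j ≢ x → adj (G ∖ x) i j ≡ adj G i j
∖-adj G {x} {i} {j} i≢x j≢x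
  rewrite dec-false (i ≟ x) i≢x | dec-false (j ≟ x) j≢x = ∧-identityʳ (adj G i j)

module ThreeCentres {G : Graph} {n : ℕ} (2≤n : 2 ≤ n)
  (avoiding  : ∀ x → Σ (Fin (V G)) λ c → Σ (FanAt G n c) λ F → Avoids F x)
  (avoiding△ : ∀ x y z → Σ (Fin (V G)) λ c → Σ (FanAt G n c) λ F → EveryEdge F (NotWithin x y z))
  (e<6n      : edgeCount G < 6 * n)
  where

  -- Each triangle of a fan with no edge inside {u , v , w} has at most one vertex there,
  -- so one of its edges misses {u , v , w}.
  outer-edges : ∀ u v w → n ≤ edgeCount (G ∖ u ∖ v ∖ w)
  outer-edges u v w with avoiding△ u v w
  ... | c , F , outside with among? u v w c
  ...   | yes c∈ = edges⇒≤-edgeCount (edges-∖ (edges-∖ (edges-∖ (rimEdges F) (off first)) (off second)) (off third))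
    where
    off : ∀ {z} → Among u v w z → AvoidedBy (rimEdges F) z
    off z∈ i = (λ { refl → proj₁ (outside i) c∈ z∈ }) , (λ { refl → proj₁ (proj₂ (outside i)) c∈ z∈ })
  ...   | no c∉ = edges⇒≤-edgeCount (edges-∖ (edges-∖ (edges-∖ spokes (off first)) (off second)) (off third))
    where
    side : ∀ i → Σ (Fin 2) λ r → ¬ Among u v w (fanEnd F (i , r))
    side i with among? u v w (left F i)
    ... | no l∉  = zero , l∉
    ... | yes l∈ = suc zero , λ r∈ → proj₂ (proj₂ (outside i)) l∈ r∈

    end : Fin n → Fin n × Fin 2
    end i = i , proj₁ (side i)

    spokes : Edges G n
    spokes = record
      { src = λ _ → c ; tgt = λ i → fanEnd F (end i)
      ; edge = λ i → fanEnd-spoke F (end i)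
      ; distinct = λ { i j (inj₁ (_ , q)) → cong proj₁ (fanEnd-injective F (end i) (end j) q)
                     ; i j (inj₂ (p , _)) → contradiction p (Adjacent⇒≢ G (fanEnd-spoke F (end j))) } }

    off : ∀ {z} → Among u v w z → AvoidedBy spokes z
    off z∈ i = (λ { refl → c∉ z∈ }) , λ eq → proj₂ (side i) (subst (Among u v w) (≡-sym eq) z∈)

  -- Deleting the three vertices in turn removes an edge between two of them once, while the degrees
  -- count it twice; the bracket on the right corrects for this. At least n edges remain at the end.
  degree-sum : ∀ {u v w} → u ≢ v → u ≢ w → v ≢ w →
    deg G u + (deg G v + (deg G w + n)) ≤ edgeCount G + ([ adj G v u ] + ([ adj G w u ] + [ adj G w v ]))
  degree-sum {u} {v} {w} u≢v u≢w v≢w = begin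
    deg G u + (deg G v + (deg G w + n))
      ≡⟨ cong₂ (λ a b → deg G u + (a + (b + n))) deg-v deg-w ⟩
    deg G u + ([vu] + dv + ([wu] + ([wv] + dw) + n))
      ≡⟨ regroup (deg G u) [vu] dv [wu] [wv] dw n ⟩
    deg G u + (dv + (dw + n)) + ([vu] + ([wu] + [wv]))
      ≤⟨ +-monoˡ-≤ _ (edges-∖-≤ G u ≤-refl
           (edges-∖-≤ (G ∖ u) v ≤-refl (edges-∖-≤ (G ∖ u ∖ v) w ≤-refl (outer-edges u v w)))) ⟩
    edgeCount G + ([vu] + ([wu] + [wv])) ∎
    where
    open ≤-Reasoning
    [vu] = [ adj G v u ]
    [wu] = [ adj G w u ]
    [wv] = [ adj G w v ]
    dv = deg (G ∖ u) v
    dw = deg (G ∖ u ∖ v) w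
    deg-v : deg G v ≡ [vu] + dv
    deg-v = deg-remove G (u≢v ∘ ≡-sym)
    deg-w : deg G w ≡ [wu] + ([wv] + dw)
    deg-w = trans (deg-remove G (u≢w ∘ ≡-sym)) (cong ([wu] +_)
      (trans (deg-remove (G ∖ u) (v≢w ∘ ≡-sym)) (cong (λ b → [ b ] + dw) (∖-adj G (u≢w ∘ ≡-sym) (u≢v ∘ ≡-sym)))))
    regroup : ∀ a b c d e f n → a + (b + c + (d + (e + f) + n)) ≡ a + (c + (f + n)) + (b + (d + e))
    regroup = solve-∀

  module _ {u v w : Fin (V G)} (Fᵤ : FanAt G n u) (Fᵥ : FanAt G n v) (F : FanAt G n w)
           (u≢v : u ≢ v) (u≢w : u ≢ w) (v≢w : v ≢ w) where

    -- The degree sum gives e(G) ≥ 7n + k - l, and l ≤ k + 2 ≤ k + n makes this at least 6n. With k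
    -- = 0 it excludes a nonadjacent pair of centres, and with k = 1, where l = 3 is allowed, a
    -- centre of degree above 2n.
    few-adjacent⇒⊥ : ∀ k {l} → k + 2 * n ≤ deg G u → [ adj G v u ] + ([ adj G w u ] + [ adj G w v ]) ≤ l → l ≤ k + 2 → ⊥
    few-adjacent⇒⊥ k {l} k≤ adj≤l l≤ = <⇒≱ e<6n (+-cancelʳ-≤ l _ _ (begin
      6 * n + l                                        ≤⟨ +-monoʳ-≤ (6 * n) (≤-trans l≤ (+-monoʳ-≤ k 2≤n)) ⟩
      6 * n + (k + n)                                  ≡⟨ regroup k n ⟩
      k + 2 * n + (2 * n + (2 * n + n))                ≤⟨ +-mono-≤ k≤ (+-mono-≤ (fan⇒≤-deg Fᵥ) (+-monoˡ-≤ n (fan⇒≤-deg F))) ⟩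
      deg G u + (deg G v + (deg G w + n))              ≤⟨ degree-sum u≢v u≢w v≢w ⟩
      edgeCount G + ([ adj G v u ] + ([ adj G w u ] + [ adj G w v ])) ≤⟨ +-monoʳ-≤ (edgeCount G) adj≤l ⟩
      edgeCount G + l                                  ∎))
      where
      open ≤-Reasoning
      regroup : ∀ k n → 6 * n + (k + n) ≡ k + 2 * n + (2 * n + (2 * n + n))
      regroup = solve-∀

    centres-adjacent : Adjacent G v u
    centres-adjacent with adj G v u in eq
    ... | true  = refl
    ... | false = ⊥-elim (few-adjacent⇒⊥ 0 (fan⇒≤-deg Fᵤ)
                    (subst (λ b → [ b ] + ([ adj G w u ] + [ adj G w v ]) ≤ 2) (≡-sym eq)
                      (+-mono-≤ ([]≤1 (adj G w u)) ([]≤1 (adj G w v)))) ≤-refl)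

    centre-degree : ¬ (1 + 2 * n ≤ deg G u)
    centre-degree 2n<d = few-adjacent⇒⊥ 1 2n<d
      (+-mono-≤ ([]≤1 (adj G v u)) (+-mono-≤ ([]≤1 (adj G w u)) ([]≤1 (adj G w v)))) ≤-refl

  -- The centre of a fan missing `u` is adjacent to `u`, so its degree exceeds 2n.
  three-centres⇒⊥ : ∀ {u v w} → FanAt G n u → FanAt G n v → FanAt G n w → u ≢ v → u ≢ w → v ≢ w → ⊥
  three-centres⇒⊥ {u} {v} {w} Fᵤ Fᵥ F u≢v u≢w v≢w with avoiding u
  ... | c , F′ , F′∌u@(c≢u , _) with c ≟ v
  -- The three centres are now `c`, `u` and one further, taken to be `v` unless c = v, and then `w`.
  ...   | no c≢v   = centre-degree F′ Fᵤ Fᵥ c≢u c≢v u≢v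
      (fan⇒<-deg F′ F′∌u (centres-adjacent Fᵤ F′ Fᵥ (c≢u ∘ ≡-sym) u≢v c≢v))
  ...   | yes refl = centre-degree F′ Fᵤ F c≢u v≢w u≢w
      (fan⇒<-deg F′ F′∌u (centres-adjacent Fᵤ F′ F u≢v u≢w v≢w))

-- The case n = 1, and the lower bound

module _ {G : Graph} {c : Fin (V G)} (F : FanAt G 1 c) where

  private
    l r : Fin (V G)
    l = left F zero
    r = right F zero

    c≢l : c ≢ l
    c≢l = Adjacent⇒≢ G (spokeˡ F zero)

    c≢r : c ≢ r
    c≢r = Adjacent⇒≢ G (spokeʳ F zero)

    l≢r : l ≢ r
    l≢r = left≢right F zero zero

  triangleEdges : Edges G 3
  triangleEdges = edges-∷ (edges-∷ (edges-∷ edges-[] (spokeˡ F zero) λ ()) (spokeʳ F zero)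
      λ { zero (inj₁ (_ , p)) → l≢r p ; zero (inj₂ (p , _)) → c≢r p })
    (rim F zero)
    λ { zero (inj₁ (p , _)) → c≢l p ; zero (inj₂ (p , _)) → c≢r p
      ; (suc zero) (inj₁ (p , _)) → c≢l p ; (suc zero) (inj₂ (p , _)) → c≢r p }

  triangleEdges-within : ∀ i → Among c l r (src triangleEdges i) × Among c l r (tgt triangleEdges i)
  triangleEdges-within zero             = second , third
  triangleEdges-within (suc zero)       = first , third
  triangleEdges-within (suc (suc zero)) = first , second

  triangleEdges-outside : ∀ {x y z} → EveryEdge F (NotWithin x y z) →
    ∀ i → NotWithin x y z (src triangleEdges i) (tgt triangleEdges i)
  triangleEdges-outside outside zero             = proj₂ (proj₂ (outside zero))
  triangleEdges-outside outside (suc zero)       = proj₁ (proj₂ (outside zero))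
  triangleEdges-outside outside (suc (suc zero)) = proj₁ (outside zero)

-- F₁ is a triangle. A second one with no edge inside the vertex set of the first is edge-disjoint
-- from it.
lower-bound-1 : ∀ G → Arrows G twoK2 (Fan 1) → 6 ≤ edgeCount G
lower-bound-1 G arrows with some-fan {n = 1} arrows
... | c , F with fan-avoiding-triangle {n = 1} arrows c (left F zero) (right F zero)
...   | c′ , F′ , outside = edges⇒≤-edgeCount (edges-++ (triangleEdges F) (triangleEdges F′) disjoint)
  where
  disjoint : ∀ i j → ¬ SameEdge (src (triangleEdges F) i) (tgt (triangleEdges F) i)
                                (src (triangleEdges F′) j) (tgt (triangleEdges F′) j)
  disjoint i j same with triangleEdges-within F i | triangleEdges-outside F′ outside j | same
  ... | p , q | out | inj₁ (s , t) = out (subst (Among _ _ _) s p) (subst (Among _ _ _) t q)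
  ... | p , q | out | inj₂ (s , t) = out (subst (Among _ _ _) t q) (subst (Among _ _ _) s p)

-- The parameter `k` stands for a value at most min(6n, 5n + 3), so that both ranges of n are served
-- by one statement.
lower-bound : ∀ {n} G → 1 ≤ n → Arrows G twoK2 (Fan n) → ∀ {k} → k ≤ 6 * n → k ≤ 5 * n + 3 → k ≤ edgeCount G
lower-bound {1} G _ arrows k≤6n _ = ≤-trans k≤6n (lower-bound-1 G arrows)
lower-bound {suc (suc m)} G 1≤n arrows {k} k≤6n k≤5n+3 with edgeCount G <? k
... | no e≮k = ≮⇒≥ e≮k
... | yes e<k = ⊥-elim (TwoCentres.two-centres⇒⊥ avoiding avoiding△
        (ThreeCentres.three-centres⇒⊥ (s≤s (s≤s z≤n)) avoiding avoiding△ (≤-trans e<k k≤6n))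
        (≤-trans e<k k≤6n) (≤-trans e<k k≤5n+3) (some-fan {n = suc (suc m)} arrows))
  where
  avoiding = fan-avoiding-vertex {n = suc (suc m)} arrows 1≤n
  avoiding△ = fan-avoiding-triangle {n = suc (suc m)} arrows

-- Extremal graphs

red-matching : ∀ {G} (κ : Colouring G) {a b c d} →
  Adjacent G a b → col κ a b ≡ red → Adjacent G c d → col κ c d ≡ red →
  a ≢ c → a ≢ d → b ≢ c → b ≢ d → HasMonoCopy G κ red twoK2
red-matching {G} κ {a} {b} {c} {d} ab ab-red cd cd-red a≢c a≢d b≢c b≢d = f , (λ {x} {y} → f-injective x y) , f-edge
  where
  f : Fin 4 → Fin (V G)
  f zero                   = a
  f (suc zero)             = b
  f (suc (suc zero))       = c
  f (suc (suc (suc zero))) = d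

  a≢b : a ≢ b
  a≢b = Adjacent⇒≢ G ab

  c≢d : c ≢ d
  c≢d = Adjacent⇒≢ G cd

  f-injective : ∀ x y → f x ≡ f y → x ≡ y
  f-injective zero zero _ = refl
  f-injective zero (suc zero) eq = contradiction eq a≢b
  f-injective zero (suc (suc zero)) eq = contradiction eq a≢c
  f-injective zero (suc (suc (suc zero))) eq = contradiction eq a≢d
  f-injective (suc zero) zero eq = contradiction (≡-sym eq) a≢b
  f-injective (suc zero) (suc zero) _ = refl
  f-injective (suc zero) (suc (suc zero)) eq = contradiction eq b≢c
  f-injective (suc zero) (suc (suc (suc zero))) eq = contradiction eq b≢d
  f-injective (suc (suc zero)) zero eq = contradiction (≡-sym eq) a≢c
  f-injective (suc (suc zero)) (suc zero) eq = contradiction (≡-sym eq) b≢c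
  f-injective (suc (suc zero)) (suc (suc zero)) _ = refl
  f-injective (suc (suc zero)) (suc (suc (suc zero))) eq = contradiction eq c≢d
  f-injective (suc (suc (suc zero))) zero eq = contradiction (≡-sym eq) a≢d
  f-injective (suc (suc (suc zero))) (suc zero) eq = contradiction (≡-sym eq) b≢d
  f-injective (suc (suc (suc zero))) (suc (suc zero)) eq = contradiction (≡-sym eq) c≢d
  f-injective (suc (suc (suc zero))) (suc (suc (suc zero))) _ = refl

  f-edge : ∀ x y → adj twoK2 x y ≡ true → Adjacent G (f x) (f y) × col κ (f x) (f y) ≡ red
  f-edge zero (suc zero) _ = ab , ab-red
  f-edge (suc zero) (suc zero) ()
  f-edge (suc zero) (suc (suc _)) ()
  f-edge (suc zero) zero _ = Adjacent-sym G ab , trans (colSym κ b a) ab-red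
  f-edge (suc (suc zero)) (suc (suc (suc zero))) _ = cd , cd-red
  f-edge (suc (suc (suc zero))) (suc (suc (suc zero))) ()
  f-edge (suc (suc (suc zero))) (suc (suc zero)) _ = Adjacent-sym G cd , trans (colSym κ d c) cd-red

-- The page is recorded because a second fan need only avoid the three vertices of that page.
record RedEdge {G n c} (κ : Colouring G) (F : FanAt G n c) : Set where
  constructor redEdge
  field
    {page} : Fin n
    {s t}  : Fin (V G)
    s∈     : Among c (left F page) (right F page) s
    t∈     : Among c (left F page) (right F page) t
    st     : Adjacent G s t
    st-red : col κ s t ≡ red

blue-or-red : ∀ {G n c} (κ : Colouring G) (F : FanAt G n c) → EveryEdge F (Blue κ {n}) ⊎ RedEdge κ F
blue-or-red {c = c} κ F with any? (λ i →
  (col κ c (left F i) ≟ᵇ red) ⊎-dec ((col κ c (right F i) ≟ᵇ red) ⊎-dec (col κ (left F i) (right F i) ≟ᵇ red)))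
... | yes (i , inj₁ p)        = inj₂ (redEdge first second (spokeˡ F i) p)
... | yes (i , inj₂ (inj₁ p)) = inj₂ (redEdge first third (spokeʳ F i) p)
... | yes (i , inj₂ (inj₂ p)) = inj₂ (redEdge second third (rim F i) p)
... | no ¬red = inj₁ λ i → ¬-not (λ p → ¬red (i , inj₁ p))
                       , ¬-not (λ p → ¬red (i , inj₂ (inj₁ p)))
                       , ¬-not (λ p → ¬red (i , inj₂ (inj₂ p)))

AvoidsPage : ∀ {G n c c′} → FanAt G n c′ → FanAt G n c → Fin n → Set
AvoidsPage {c = c} F′ F k = Avoids F′ c × Avoids F′ (left F k) × Avoids F′ (right F k)

avoidsPage⇒≢ : ∀ {G n c c′ x y} (F′ : FanAt G n c′) (F : FanAt G n c) {k l} → AvoidsPage F′ F k →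
  Among c (left F k) (right F k) x → Among c′ (left F′ l) (right F′ l) y → x ≢ y
avoidsPage⇒≢ {x = x} F′ F {k} {l} (¬c , ¬l , ¬r) x∈ y∈ x≡y = off y∈ (avoided x∈) (≡-sym x≡y)
  where
  avoided : Among _ (left F k) (right F k) x → Avoids F′ x
  avoided first  = ¬c
  avoided second = ¬l
  avoided third  = ¬r
  off : ∀ {y} → Among _ (left F′ l) (right F′ l) y → Avoids F′ x → y ≢ x
  off first  (c≢ , _ , _) = c≢
  off second (_ , l≢ , _) = l≢ l
  off third  (_ , _ , r≢) = r≢ l

-- A red edge in page k of F and a red edge in the fan avoiding that page form a red 2K₂.
arrows-from-fans : ∀ {G n c} (F : FanAt G n c) →
  (∀ k → Σ (Fin (V G)) λ c′ → Σ (FanAt G n c′) λ F′ → AvoidsPage F′ F k) → Arrows G twoK2 (Fan n)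
arrows-from-fans {n = n} F others κ with blue-or-red κ F
... | inj₁ F-blue = inj₂ (fan⇒copy κ {n} F F-blue)
... | inj₂ (redEdge {k} s∈ t∈ st st-red) with others k
...   | c′ , F′ , apart with blue-or-red κ F′
...     | inj₁ F′-blue = inj₂ (fan⇒copy κ {n} F′ F′-blue)
...     | inj₂ (redEdge s′∈ t′∈ s′t′ s′t′-red) = inj₁ (red-matching κ st st-red s′t′ s′t′-red
            (avoidsPage⇒≢ F′ F apart s∈ s′∈) (avoidsPage⇒≢ F′ F apart s∈ t′∈)
            (avoidsPage⇒≢ F′ F apart t∈ s′∈) (avoidsPage⇒≢ F′ F apart t∈ t′∈))

-- Two hubs 0 and 1 over the matching {2+2i , 3+2i}, i < m:
-- hub 0 is joined to the pairs with i < s, hub 1 to those with i ≥ t.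

-- Recursion by two makes a shift past one matched pair definitional, as the edge counts below
-- require.
even : ℕ → Bool
even zero          = true
even (suc zero)    = false
even (suc (suc x)) = even x

hubEdge : ℕ → ℕ → ℕ → ℕ → Bool
hubEdge s t 0             (suc (suc y)) = y <ᵇ s * 2
hubEdge s t 1             (suc (suc y)) = t * 2 ≤ᵇ y
hubEdge s t (suc (suc x)) (suc (suc y)) = even x ∧ (y ≡ᵇ suc x)
hubEdge s t _             _             = false

hubs : ℕ → ℕ → ℕ → Graph
hubs m s t = mkGraph (suc (suc (m * 2))) (hubEdge s t)

mkGraph-adj : ∀ {n} e {i j : Fin n} → toℕ i < toℕ j → e (toℕ i) (toℕ j) ≡ true → Adjacent (mkGraph n e) i j
mkGraph-adj e i<j eij rewrite <ᵇ-true i<j | eij = refl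

module Hubs {m s t : ℕ} where

  pair : Fin m → Fin 2 → Fin (suc (suc (m * 2)))
  pair i r = suc (suc (combine i r))

  pair-injective : ∀ {i j r q} → pair i r ≡ pair j q → i ≡ j × r ≡ q
  pair-injective {i} {j} {r} {q} eq = combine-injective i r j q (suc-injective (suc-injective eq))

  even-2* : ∀ i → even (2 * i + 0) ≡ true
  even-2* zero = refl
  even-2* (suc i) = subst (λ k → even k ≡ true) (shift i) (even-2* i)
    where
    shift : ∀ i → suc (suc (2 * i + 0)) ≡ 2 * suc i + 0
    shift = solve-∀

  matched : ∀ i → Adjacent (hubs m s t) (pair i zero) (pair i (suc zero))
  matched i = mkGraph-adj (hubEdge s t) {pair i zero} {pair i (suc zero)} below edge′
    where
    next : toℕ (combine i (suc zero)) ≡ suc (toℕ (combine i zero))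
    next = trans (toℕ-combine i (suc zero)) (trans (shift (toℕ i)) (cong suc (≡-sym (toℕ-combine i zero))))
      where
      shift : ∀ i → 2 * i + 1 ≡ suc (2 * i + 0)
      shift = solve-∀
    below : toℕ (pair i zero) < toℕ (pair i (suc zero))
    below = s≤s (s≤s (≤-reflexive (≡-sym next)))
    edge′ : even (toℕ (combine i zero)) ∧ (toℕ (combine i (suc zero)) ≡ᵇ suc (toℕ (combine i zero))) ≡ true
    edge′ = cong₂ _∧_ (trans (cong even (toℕ-combine i zero)) (even-2* (toℕ i)))
              (trans (cong (_≡ᵇ suc (toℕ (combine i zero))) next) (≡ᵇ-refl (toℕ (combine i zero))))

  hub-0 : ∀ i r → toℕ i < s → Adjacent (hubs m s t) zero (pair i r)
  hub-0 i r i<s = mkGraph-adj (hubEdge s t) {zero} {pair i r} (s≤s z≤n) (<ᵇ-true (begin-strict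
    toℕ (combine i r)    ≡⟨ toℕ-combine i r ⟩
    2 * toℕ i + toℕ r    <⟨ +-monoʳ-< (2 * toℕ i) (toℕ<n r) ⟩
    2 * toℕ i + 2        ≡⟨ shift (toℕ i) ⟩
    suc (toℕ i) * 2      ≤⟨ *-monoˡ-≤ 2 i<s ⟩
    s * 2                ∎))
    where
    open ≤-Reasoning
    shift : ∀ i → 2 * i + 2 ≡ suc i * 2
    shift = solve-∀

  hub-1 : ∀ i r → t ≤ toℕ i → Adjacent (hubs m s t) (suc zero) (pair i r)
  hub-1 i r t≤i = mkGraph-adj (hubEdge s t) {suc zero} {pair i r} (s≤s (s≤s z≤n)) (Equivalence.to T-≡ (≤⇒≤ᵇ (begin
    t * 2                ≤⟨ *-monoˡ-≤ 2 t≤i ⟩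
    toℕ i * 2            ≡⟨ *-comm (toℕ i) 2 ⟩
    2 * toℕ i            ≤⟨ m≤m+n (2 * toℕ i) (toℕ r) ⟩
    2 * toℕ i + toℕ r    ≡⟨ toℕ-combine i r ⟨
    toℕ (combine i r)    ∎)))
    where open ≤-Reasoning

  hubFan : ∀ {n} c (ι : Fin n → Fin m) → (∀ {k l} → ι k ≡ ι l → k ≡ l) →
    (∀ k r → Adjacent (hubs m s t) c (pair (ι k) r)) → FanAt (hubs m s t) n c
  hubFan c ι ι-inj spokes = record
    { left = λ k → pair (ι k) zero ; right = λ k → pair (ι k) (suc zero)
    ; spokeˡ = λ k → spokes k zero ; spokeʳ = λ k → spokes k (suc zero)
    ; rim = λ k → matched (ι k)
    ; left-injective = λ eq → ι-inj (proj₁ (pair-injective eq))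
    ; right-injective = λ eq → ι-inj (proj₁ (pair-injective eq))
    ; left≢right = λ k l eq → contradiction (proj₂ (pair-injective {ι k} {ι l} eq)) λ () }

  -- The fan at hub 1 uses the pairs `ι`. For each of its pages `k`, the fan at hub 0 on the pairs
  -- `ο k` omits the pair of that page.
  hubs-arrow : ∀ {n} (ι : Fin n → Fin m) (ο : Fin n → Fin n → Fin m) →
    (∀ {k l} → ι k ≡ ι l → k ≡ l) → (∀ k {i j} → ο k i ≡ ο k j → i ≡ j) →
    (∀ k → t ≤ toℕ (ι k)) → (∀ k i → toℕ (ο k i) < s) → (∀ k i → ο k i ≢ ι k) →
    Arrows (hubs m s t) twoK2 (Fan n)
  hubs-arrow ι ο ι-inj ο-inj t≤ι ο<s ο≢ι = arrows-from-fans (hubFan (suc zero) ι ι-inj (λ k r → hub-1 (ι k) r (t≤ι k)))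
    λ k → zero , hubFan zero (ο k) (ο-inj k) (λ i r → hub-0 (ο k i) r (ο<s k i))
        , ((λ ()) , (λ i ()) , (λ i ()))
        , ((λ ()) , (λ i eq → ο≢ι k i (proj₁ (pair-injective eq))) , (λ i eq → ο≢ι k i (proj₁ (pair-injective eq))))
        , ((λ ()) , (λ i eq → ο≢ι k i (proj₁ (pair-injective eq))) , (λ i eq → ο≢ι k i (proj₁ (pair-injective eq))))

two-fans-arrow : ∀ n → Arrows (hubs (n + n) n n) twoK2 (Fan n)
two-fans-arrow n = Hubs.hubs-arrow (n ↑ʳ_) (λ _ i → i ↑ˡ n) (↑ʳ-injective n _ _) (λ _ → ↑ˡ-injective n _ _)
  (λ k → subst (n ≤_) (≡-sym (toℕ-↑ʳ n k)) (m≤m+n n (toℕ k)))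
  (λ _ i → subst (_< n) (≡-sym (toℕ-↑ˡ i n)) (toℕ<n i))
  (λ k i eq → contradiction (trans (≡-sym (splitAt-↑ˡ n i n)) (trans (cong (splitAt n) eq) (splitAt-↑ʳ n n k))) λ ())

-- Hub 0 is joined to all n + 1 pairs, so any one pair can be skipped, which `punchIn` does; pair 0
-- is missing at hub 1.
overlapping-fans-arrow : ∀ n → Arrows (hubs (suc n) (suc n) 1) twoK2 (Fan n)
overlapping-fans-arrow n = Hubs.hubs-arrow suc (λ k → punchIn (suc k)) suc-injective (λ k → punchIn-injective (suc k) _ _)
  (λ k → s≤s z≤n) (λ k i → toℕ<n (punchIn (suc k) i)) (λ k i → punchInᵢ≢i (suc k) i)

-- Edge counts of the extremal graphs

Σ<-one : ∀ n → Σ< {n} (λ _ → 1) ≡ n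
Σ<-one zero = refl
Σ<-one (suc n) = trans (Σ<-suc {n} (λ _ → 1)) (cong suc (Σ<-one n))

Σ<-suc² : ∀ {n} (f : Fin (suc (suc n)) → ℕ) → Σ< f ≡ f zero + (f (suc zero) + Σ< {n} (λ i → f (suc (suc i))))
Σ<-suc² {n} f = trans (Σ<-suc f) (cong (f zero +_) (Σ<-suc {n} (λ i → f (suc i))))

-- The summand of `edgeCount` for a graph built by `mkGraph`, in terms of vertex numbers.
rowEntry : (ℕ → ℕ → Bool) → ℕ → ℕ → ℕ
rowEntry e x y = [ (x <ᵇ y) ∧ (((x <ᵇ y) ∧ e x y) ∨ ((y <ᵇ x) ∧ e y x)) ]

matchingEdge : ℕ → ℕ → Bool
matchingEdge x y = even x ∧ (y ≡ᵇ suc x)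

matching-count : ∀ m → Σ< {m * 2} (λ i → Σ< {m * 2} (λ j → rowEntry matchingEdge (toℕ i) (toℕ j))) ≡ m
matching-count zero = refl
matching-count (suc m) = begin
  Σ< row                                                  ≡⟨ Σ<-suc² {m * 2} row ⟩
  row zero + (row (suc zero) + Σ< {m * 2} (λ i → row (suc (suc i)))) ≡⟨ cong₂ _+_ row-0 (cong₂ _+_ row-1 (Σ<-cong {m * 2} row-2)) ⟩
  1 + (0 + Σ< {m * 2} (λ i → Σ< {m * 2} (λ j → rowEntry matchingEdge (toℕ i) (toℕ j)))) ≡⟨ cong suc (matching-count m) ⟩
  suc m                                                   ∎
  where
  open ≡-Reasoning
  row : Fin (suc m * 2) → ℕ
  row i = Σ< {suc m * 2} (λ j → rowEntry matchingEdge (toℕ i) (toℕ j))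
  row-0 : row zero ≡ 1
  row-0 = trans (Σ<-suc² {m * 2} (λ j → rowEntry matchingEdge 0 (toℕ j))) (cong suc (Σ<-zero (m * 2)))
  row-1 : row (suc zero) ≡ 0
  row-1 = trans (Σ<-suc² {m * 2} (λ j → rowEntry matchingEdge 1 (toℕ j))) (Σ<-zero (m * 2))
  row-2 : ∀ i → row (suc (suc i)) ≡ Σ< {m * 2} (λ j → rowEntry matchingEdge (toℕ i) (toℕ j))
  row-2 i = Σ<-suc² {m * 2} (λ j → rowEntry matchingEdge (suc (suc (toℕ i))) (toℕ j))

-- Hub 0 contributes 2(n + 1) edges, hub 1 contributes 2n, and the matching n + 1.
overlapping-fans-edgeCount : ∀ n → edgeCount (hubs (suc n) (suc n) 1) ≡ 5 * n + 3
overlapping-fans-edgeCount n = begin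
  Σ< row                                                  ≡⟨ Σ<-suc² {suc n * 2} row ⟩
  row zero + (row (suc zero) + Σ< {suc n * 2} (λ i → row (suc (suc i))))
    ≡⟨ cong₂ _+_ row-0 (cong₂ _+_ row-1 (trans (Σ<-cong {suc n * 2} row-2) (matching-count (suc n)))) ⟩
  suc n * 2 + (n * 2 + suc n)                             ≡⟨ regroup n ⟩
  5 * n + 3                                               ∎
  where
  open ≡-Reasoning
  e : ℕ → ℕ → Bool
  e = hubEdge (suc n) 1
  row : Fin (suc (suc (suc n * 2))) → ℕ
  row i = Σ< {suc (suc (suc n * 2))} (λ j → rowEntry e (toℕ i) (toℕ j))
  row-0 : row zero ≡ suc n * 2
  row-0 = trans (Σ<-suc² {suc n * 2} (λ j → rowEntry e 0 (toℕ j)))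
    (trans (Σ<-cong {suc n * 2} joined) (Σ<-one (suc n * 2)))
    where
    joined : ∀ (j : Fin (suc n * 2)) → rowEntry e 0 (suc (suc (toℕ j))) ≡ 1
    joined j rewrite <ᵇ-true (toℕ<n j) = refl
  row-1 : row (suc zero) ≡ n * 2
  row-1 = trans (Σ<-suc² {suc n * 2} (λ j → rowEntry e 1 (toℕ j)))
    (trans (Σ<-suc² {n * 2} (λ j → rowEntry e 1 (suc (suc (toℕ j))))) (Σ<-one (n * 2)))
  row-2 : ∀ i → row (suc (suc i)) ≡ Σ< {suc n * 2} (λ j → rowEntry matchingEdge (toℕ i) (toℕ j))
  row-2 i = Σ<-suc² {suc n * 2} (λ j → rowEntry e (suc (suc (toℕ i))) (toℕ j))
  regroup : ∀ n → suc n * 2 + (n * 2 + suc n) ≡ 5 * n + 3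
  regroup = solve-∀

theorem5 : (n : ℕ) → 1 ≤ n →
    (n ≤ 2 → IsSizeRamsey twoK2 (Fan n) (6 * n)) ×
    (3 ≤ n → IsSizeRamsey twoK2 (Fan n) (5 * n + 3))
theorem5 n 1≤n = small n 1≤n , large
  where
  small : ∀ n → 1 ≤ n → n ≤ 2 → IsSizeRamsey twoK2 (Fan n) (6 * n)
  -- For n = 1 and n = 2 the edge count is found by evaluation, and 6n ≤ 5n + 3 reads 6 ≤ 8 and 12 ≤
  -- 13.
  small 1 1≤n _ = (hubs 2 1 1 , refl , two-fans-arrow 1)
    , λ G arrows → lower-bound G 1≤n arrows ≤-refl (m≤n+m 6 2)
  small 2 1≤n _ = (hubs 4 2 2 , refl , two-fans-arrow 2)
    , λ G arrows → lower-bound G 1≤n arrows ≤-refl (m≤n+m 12 1)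
  small (suc (suc (suc _))) _ (s≤s (s≤s ()))

  large : 3 ≤ n → IsSizeRamsey twoK2 (Fan n) (5 * n + 3)
  large 3≤n = (hubs (suc n) (suc n) 1 , overlapping-fans-edgeCount n , overlapping-fans-arrow n)
    , λ G arrows → lower-bound G 1≤n arrows 5n+3≤6n ≤-refl
    where
    5n+3≤6n : 5 * n + 3 ≤ 6 * n
    5n+3≤6n = subst (5 * n + 3 ≤_) (+-comm (5 * n) n) (+-monoʳ-≤ (5 * n) 3≤n)
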